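{- Let $\mathbb{F}$ be any field, let $d$ and $m$ be integers with $1\le m\le d-1$. Let $(\mathcal J,\mathcal L,\mathcal F)$ be a $(1^m,d-m)$-joints configuration in $\mathbb{F}^d$. Then \[ |\mathcal J|\le \binom{d}{m}^{1/m}\,|\mathcal L|\,|\mathcal F|^{1/m}. \]
   Context: A $(1^m,d-m)$-joints configuration $(\mathcal J,\mathcal L,\mathcal F)$ in $\mathbb{F}^d$ consists of a finite set $\mathcal L$ of lines in $\mathbb{F}^d$, a finite set $\mathcal F$ of $(d-m)$-dimensional affine subspaces ($(d-m)$-flats) of $\mathbb{F}^d$, and a set $\mathcal J$ of joints, each joint being a point that is the intersection of $m$ lines from $\mathcal L$ and one flat from $\mathcal F$, these $m$ lines and the flat not all lying in some hyperplane (equivalently, the directions of the $m$ lines together with the direction space of the flat span $\mathbb{F}^d$). -}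

module Defs where

open import Level using (Level; _⊔_)
open import Algebra.Bundles using (CommutativeRing)
import Data.Nat as ℕ
open ℕ using (ℕ)
open import Data.Fin using (Fin; zero; suc)
open import Data.List using (List; length)
open import Data.List.Membership.Propositional using (_∈_)
open import Data.Product using (Σ; ∃; ∃-syntax; _×_; _,_)
open import Relation.Nullary using (¬_)

record Field (c ℓ : Level) : Set (Level.suc (c ⊔ ℓ)) where
  field
    commutativeRing : CommutativeRing c ℓ
  open CommutativeRing commutativeRing public
  field
    1≉0     : ¬ (1# ≈ 0#)
    inverse : ∀ x → ¬ (x ≈ 0#) → ∃[ y ] (x * y ≈ 1#)

module LinearAlgebra {c ℓ : Level} (𝔽 : Field c ℓ) where
  open Field 𝔽 using (Carrier; _≈_; _+_; _*_; 0#; 1#)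

  Vect : ℕ → Set c
  Vect d = Fin d → Carrier

  _≈ᵥ_ : ∀ {d} → Vect d → Vect d → Set ℓ
  u ≈ᵥ v = ∀ i → u i ≈ v i

  0ᵥ : ∀ {d} → Vect d
  0ᵥ _ = 0#

  _+ᵥ_ : ∀ {d} → Vect d → Vect d → Vect d
  (u +ᵥ v) i = u i + v i

  _·_ : ∀ {d} → Carrier → Vect d → Vect d
  (t · v) i = t * v i

  lincomb : ∀ {d} k → (Fin k → Carrier) → (Fin k → Vect d) → Vect d
  lincomb ℕ.zero    a w = 0ᵥ
  lincomb (ℕ.suc k) a w = (a zero · w zero) +ᵥ lincomb k (λ i → a (suc i)) (λ i → w (suc i))

  LinearlyIndependent : ∀ {d} k → (Fin k → Vect d) → Set (c ⊔ ℓ)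
  LinearlyIndependent k w = ∀ a → lincomb k a w ≈ᵥ 0ᵥ → ∀ i → a i ≈ 0#

  record Line (d : ℕ) : Set (c ⊔ ℓ) where
    constructor mkLine
    field
      base      : Vect d
      dir       : Vect d
      dir≉0     : ¬ (dir ≈ᵥ 0ᵥ)

  record Flat (d k : ℕ) : Set (c ⊔ ℓ) where
    constructor mkFlat
    field
      base   : Vect d
      dirs   : Fin k → Vect d
      indep  : LinearlyIndependent k dirs

  OnLine : ∀ {d} → Vect d → Line d → Set (c ⊔ ℓ)
  OnLine p l = ∃[ t ] (p ≈ᵥ (Line.base l +ᵥ (t · Line.dir l)))

  OnFlat : ∀ {d k} → Vect d → Flat d k → Set (c ⊔ ℓ)
  OnFlat {k = k} p f = ∃[ a ] (p ≈ᵥ (Flat.base f +ᵥ lincomb k a (Flat.dirs f)))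

  Spans : ∀ {d m k} → (Fin m → Line d) → Flat d k → Set (c ⊔ ℓ)
  Spans {d} {m} {k} ls f =
    ∀ (x : Vect d) → ∃[ a ] ∃[ b ]
      (x ≈ᵥ (lincomb m a (λ i → Line.dir (ls i)) +ᵥ lincomb k b (Flat.dirs f)))

  IsJoint : ∀ {d} m {k} → List (Line d) → List (Flat d k) → Vect d → Set (c ⊔ ℓ)
  IsJoint {d} m ℒ ℱ p =
    Σ (Fin m → Line d) λ ls → Σ (Flat d _) λ f →
      (∀ i → ls i ∈ ℒ) × f ∈ ℱ × (∀ i → OnLine p (ls i)) × OnFlat p f × Spans ls f

{-# OPTIONS --safe #-}

-- Suppose |𝒥|^m > C(d,m) |ℒ|^m |ℱ|.  Counting coefficients gives M and D with M |𝒥| > D |ℒ| and a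
-- nonzero polynomial g of degree at most D vanishing to order M along every flat (only flats through a
-- joint matter).  At a joint p let α be the exponent of a nonzero term of lowest total degree v_p
-- in the expansion of g in the frame of p: its first m coordinates belong to the lines and sum to at
-- least M.  If g vanishes to order v_ℓ along a line ℓ, then the exponent of ℓ in α is at most v_p - v_ℓ,
-- while a nonzero leading coefficient of g along ℓ is a univariate polynomial of degree at most D
-- divisible by (t - τ)^(v_p - v_ℓ) for every joint p = b + τ u on ℓ.  Hence the exponents of ℓ at the
-- joints on it sum to at most D, and summing over all lines gives M |𝒥| ≤ D |ℒ|.
module Submission where

open import Defs
open import Level using (Level; _⊔_) renaming (suc to lsuc)
open import Algebra.Bundles using (CommutativeRing)
import Algebra.Properties.AbelianGroup as AbelianGroupProperties
import Algebra.Properties.CommutativeSemigroup as CommutativeSemigroupProperties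
import Algebra.Properties.Ring as RingProperties
import Algebra.Properties.Semiring.Sum as SemiringSum
open import Data.Bool using (Bool; true; false; if_then_else_)
open import Data.Empty using (⊥-elim)
open import Data.Fin as Fin using (Fin; zero; suc; punchIn; _↑ˡ_; _↑ʳ_; splitAt)
import Data.Fin.Properties as Fin
open import Data.List as List using (List; []; _∷_; map; length)
import Data.List.Properties as List
open import Data.List.Membership.Propositional using (_∈_)
open import Data.List.Membership.Propositional.Properties
  using (∈-++⁺ˡ; ∈-++⁺ʳ; ∈-map⁺; ∈-lookup; ∈-allFin; ∈-cartesianProductWith⁺)
open import Data.List.Relation.Unary.All as All using (All; []; _∷_)
import Data.List.Relation.Unary.All.Properties as All
open import Data.List.Relation.Unary.AllPairs using (AllPairs; []; _∷_)
open import Data.List.Relation.Unary.Any using (here; index)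
open import Data.List.Relation.Unary.Any.Properties using (lookup-index)
open import Data.Nat as ℕ using (ℕ; zero; suc; z≤n; s≤s)
open import Data.Nat.Combinatorics using (_C_; nCk≡n!/k![n-k]!; k![n∸k]!∣n!)
open import Data.Nat.DivMod using (m≡m%n+[m/n]*n; m%n<n; m/n*n≤m; m/n*n≡m)
import Data.Nat.Properties as ℕ
open import Data.Nat.Solver using (module +-*-Solver)
open import Data.Product using (Σ; ∃; ∃-syntax; _×_; _,_; proj₁; proj₂)
open import Data.Sum using (_⊎_; inj₁; inj₂)
open import Data.Vec as Vec using (Vec; []; _∷_; replicate; zipWith)
open import Data.Vec.Functional using (insertAt; _++_)
open import Data.Vec.Functional.Properties using (insertAt-lookup; insertAt-punchIn; lookup-++ˡ; lookup-++ʳ)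
open import Function using (_∘_)
open import Relation.Binary.PropositionalEquality as ≡ using (_≡_; _≢_)
import Relation.Binary.Reasoning.Setoid as SetoidReasoning
open import Relation.Nullary using (¬_; Dec; yes; no; does)
open import Relation.Nullary.Decidable using (decidable-stable)

-- Univariate polynomials

-- The constant comes from comparing leading terms. Vanishing to order M along one flat costs about
-- M^m D^(d-m) / (m! (d-m)!) linear conditions, against about D^d / d! coefficients. A suitable g
-- therefore exists once D / M exceeds (C(d,m) |ℱ|)^(1/m), up to lower-order terms, and the assumed
-- inequality leaves room for D / M between this root and |𝒥| / |ℒ|. The frames change from joint to
-- joint, so orders of vanishing have to be compared across frames. Ordinary derivatives lose
-- information in positive characteristic; polynomials are expanded by substitution instead. Each
-- estimate (order along a flat, at a joint or along a line, divisibility by a power of t - τ,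
-- degree) then says that a substitution respects a filtration, and `ev-∈` serves them all. Equality
-- in the field is not decidable, so pivots, leading terms and g itself exist only up to double
-- negation. The inequalities between natural numbers that are drawn from them are decidable and
-- absorb this.

module Polynomials {c ℓ} (R : CommutativeRing c ℓ) where
  open CommutativeRing R hiding (zero)
  open CommutativeSemigroupProperties +-commutativeSemigroup
    using () renaming (interchange to +-interchange; x∙yz≈y∙xz to x+yz≈y+xz)
  open RingProperties ring using (-0#≈0#)
  open SetoidReasoning setoid

  -- Trailing zeros are allowed: without decidable equality there is no normal form, so equality is
  -- taken coefficient by coefficient.
  Poly : Set c
  Poly = List Carrier

  coeff : Poly → ℕ → Carrier
  coeff []      _       = 0#
  coeff (a ∷ f) zero    = a
  coeff (a ∷ f) (suc n) = coeff f n

  infix 4 _≈ₚ_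
  -- A record rather than a bare function type, so that both polynomials can be inferred from a
  -- proof of their equality.
  record _≈ₚ_ (f g : Poly) : Set ℓ where
    constructor mk≈
    field at : ∀ n → coeff f n ≈ coeff g n
  open _≈ₚ_ public

  infixl 6 _+ₚ_
  infixl 7 _*ₚ_
  _+ₚ_ : Poly → Poly → Poly
  []      +ₚ g       = g
  (a ∷ f) +ₚ []      = a ∷ f
  (a ∷ f) +ₚ (b ∷ g) = a + b ∷ f +ₚ g

  _*ₚ_ : Poly → Poly → Poly
  []      *ₚ g = []
  (a ∷ f) *ₚ g = map (a *_) g +ₚ (0# ∷ f *ₚ g)

  negₚ : Poly → Poly
  negₚ = map (λ a → - a)

  coeff-+ : ∀ f g n → coeff (f +ₚ g) n ≈ coeff f n + coeff g n
  coeff-+ []      g       n       = sym (+-identityˡ _)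
  coeff-+ (a ∷ f) []      n       = sym (+-identityʳ _)
  coeff-+ (a ∷ f) (b ∷ g) zero    = refl
  coeff-+ (a ∷ f) (b ∷ g) (suc n) = coeff-+ f g n

  coeff-scale : ∀ a g n → coeff (map (a *_) g) n ≈ a * coeff g n
  coeff-scale a []      n       = sym (zeroʳ a)
  coeff-scale a (b ∷ g) zero    = refl
  coeff-scale a (b ∷ g) (suc n) = coeff-scale a g n

  coeff-neg : ∀ g n → coeff (negₚ g) n ≈ - coeff g n
  coeff-neg []      n       = sym -0#≈0#
  coeff-neg (b ∷ g) zero    = refl
  coeff-neg (b ∷ g) (suc n) = coeff-neg g n

  coeff-*-zero : ∀ a f g → coeff ((a ∷ f) *ₚ g) zero ≈ a * coeff g zero
  coeff-*-zero a f g = begin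
    coeff (map (a *_) g +ₚ (0# ∷ f *ₚ g)) zero ≈⟨ coeff-+ (map (a *_) g) _ zero ⟩
    coeff (map (a *_) g) zero + 0#             ≈⟨ +-identityʳ _ ⟩
    coeff (map (a *_) g) zero                  ≈⟨ coeff-scale a g zero ⟩
    a * coeff g zero                           ∎

  coeff-*-suc : ∀ a f g n →
    coeff ((a ∷ f) *ₚ g) (suc n) ≈ a * coeff g (suc n) + coeff (f *ₚ g) n
  coeff-*-suc a f g n = trans (coeff-+ (map (a *_) g) _ (suc n)) (+-congʳ (coeff-scale a g (suc n)))

  private
    +ₚ-cong : ∀ {f f′ g g′} → f ≈ₚ f′ → g ≈ₚ g′ → f +ₚ g ≈ₚ f′ +ₚ g′
    +ₚ-cong {f} {f′} {g} {g′} p q .at n =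
      trans (coeff-+ f g n) (trans (+-cong (at p n) (at q n)) (sym (coeff-+ f′ g′ n)))

    negₚ-cong : ∀ {f g} → f ≈ₚ g → negₚ f ≈ₚ negₚ g
    negₚ-cong {f} {g} p .at n = trans (coeff-neg f n) (trans (-‿cong (at p n)) (sym (coeff-neg g n)))

    +ₚ-assoc : ∀ f g h → (f +ₚ g) +ₚ h ≈ₚ f +ₚ (g +ₚ h)
    +ₚ-assoc f g h .at n = begin
      coeff ((f +ₚ g) +ₚ h) n               ≈⟨ coeff-+ (f +ₚ g) h n ⟩
      coeff (f +ₚ g) n + coeff h n          ≈⟨ +-congʳ (coeff-+ f g n) ⟩
      coeff f n + coeff g n + coeff h n     ≈⟨ +-assoc _ _ _ ⟩
      coeff f n + (coeff g n + coeff h n)   ≈⟨ +-congˡ (coeff-+ g h n) ⟨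
      coeff f n + coeff (g +ₚ h) n          ≈⟨ coeff-+ f (g +ₚ h) n ⟨
      coeff (f +ₚ (g +ₚ h)) n               ∎

    +ₚ-comm : ∀ f g → f +ₚ g ≈ₚ g +ₚ f
    +ₚ-comm f g .at n = trans (coeff-+ f g n) (trans (+-comm _ _) (sym (coeff-+ g f n)))

    +ₚ-identityʳ : ∀ f → f +ₚ [] ≈ₚ f
    +ₚ-identityʳ f .at n = trans (coeff-+ f [] n) (+-identityʳ _)

    negₚ-inverseˡ : ∀ f → negₚ f +ₚ f ≈ₚ []
    negₚ-inverseˡ f .at n =
      trans (coeff-+ (negₚ f) f n) (trans (+-congʳ (coeff-neg f n)) (-‿inverseˡ _))

    ≈ₚ-trans : ∀ {f g h} → f ≈ₚ g → g ≈ₚ h → f ≈ₚ h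
    ≈ₚ-trans p q .at n = trans (at p n) (at q n)

    *ₚ-zeroʳ : ∀ f n → coeff (f *ₚ []) n ≈ 0#
    *ₚ-zeroʳ []      n       = refl
    *ₚ-zeroʳ (a ∷ f) zero    = refl
    *ₚ-zeroʳ (a ∷ f) (suc n) = *ₚ-zeroʳ f n

    -- The product recurses on its left factor. This and the next lemma give the recursion on the
    -- right factor; commutativity follows by matching the two, and the remaining right-hand laws
    -- follow from commutativity.
    *ₚ-∷ʳ-zero : ∀ f b g → coeff (f *ₚ (b ∷ g)) zero ≈ b * coeff f zero
    *ₚ-∷ʳ-zero []      b g = sym (zeroʳ b)
    *ₚ-∷ʳ-zero (a ∷ f) b g = trans (coeff-*-zero a f (b ∷ g)) (*-comm a b)

    *ₚ-∷ʳ-suc : ∀ f b g n →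
      coeff (f *ₚ (b ∷ g)) (suc n) ≈ b * coeff f (suc n) + coeff (f *ₚ g) n
    *ₚ-∷ʳ-suc []      b g n = sym (trans (+-identityʳ _) (zeroʳ b))
    *ₚ-∷ʳ-suc (a ∷ f) b g zero = begin
      coeff ((a ∷ f) *ₚ (b ∷ g)) 1                  ≈⟨ coeff-*-suc a f (b ∷ g) 0 ⟩
      a * coeff g 0 + coeff (f *ₚ (b ∷ g)) 0        ≈⟨ +-congˡ (*ₚ-∷ʳ-zero f b g) ⟩
      a * coeff g 0 + b * coeff f 0                 ≈⟨ +-comm _ _ ⟩
      b * coeff f 0 + a * coeff g 0                 ≈⟨ +-congˡ (coeff-*-zero a f g) ⟨
      b * coeff f 0 + coeff ((a ∷ f) *ₚ g) 0        ∎
    *ₚ-∷ʳ-suc (a ∷ f) b g (suc n) = begin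
      coeff ((a ∷ f) *ₚ (b ∷ g)) (2 ℕ.+ n)
        ≈⟨ coeff-*-suc a f (b ∷ g) (suc n) ⟩
      a * coeff g (suc n) + coeff (f *ₚ (b ∷ g)) (suc n)
        ≈⟨ +-congˡ (*ₚ-∷ʳ-suc f b g n) ⟩
      a * coeff g (suc n) + (b * coeff f (suc n) + coeff (f *ₚ g) n)
        ≈⟨ x+yz≈y+xz _ _ _ ⟩
      b * coeff f (suc n) + (a * coeff g (suc n) + coeff (f *ₚ g) n)
        ≈⟨ +-congˡ (coeff-*-suc a f g n) ⟨
      b * coeff f (suc n) + coeff ((a ∷ f) *ₚ g) (suc n) ∎

    *ₚ-comm-at : ∀ f g n → coeff (f *ₚ g) n ≈ coeff (g *ₚ f) n
    *ₚ-comm-at []      g n       = sym (*ₚ-zeroʳ g n)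
    *ₚ-comm-at (a ∷ f) g zero    = trans (coeff-*-zero a f g) (sym (*ₚ-∷ʳ-zero g a f))
    *ₚ-comm-at (a ∷ f) g (suc n) =
      trans (coeff-*-suc a f g n) (trans (+-congˡ (*ₚ-comm-at f g n)) (sym (*ₚ-∷ʳ-suc g a f n)))

    *ₚ-comm : ∀ f g → f *ₚ g ≈ₚ g *ₚ f
    *ₚ-comm f g .at = *ₚ-comm-at f g

    *ₚ-congˡ-at : ∀ f {g g′} → g ≈ₚ g′ → ∀ n → coeff (f *ₚ g) n ≈ coeff (f *ₚ g′) n
    *ₚ-congˡ-at []      p n = refl
    *ₚ-congˡ-at (a ∷ f) {g} {g′} p zero =
      trans (coeff-*-zero a f g) (trans (*-congˡ (at p 0)) (sym (coeff-*-zero a f g′)))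
    *ₚ-congˡ-at (a ∷ f) {g} {g′} p (suc n) =
      trans (coeff-*-suc a f g n)
        (trans (+-cong (*-congˡ (at p (suc n))) (*ₚ-congˡ-at f p n)) (sym (coeff-*-suc a f g′ n)))

    *ₚ-cong : ∀ {f f′ g g′} → f ≈ₚ f′ → g ≈ₚ g′ → f *ₚ g ≈ₚ f′ *ₚ g′
    *ₚ-cong {f} {f′} {g} {g′} p q .at n = begin
      coeff (f *ₚ g) n   ≈⟨ *ₚ-congˡ-at f q n ⟩
      coeff (f *ₚ g′) n  ≈⟨ *ₚ-comm-at f g′ n ⟩
      coeff (g′ *ₚ f) n  ≈⟨ *ₚ-congˡ-at g′ p n ⟩
      coeff (g′ *ₚ f′) n ≈⟨ *ₚ-comm-at g′ f′ n ⟩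
      coeff (f′ *ₚ g′) n ∎

    *ₚ-distribˡ-at : ∀ f g h n → coeff (f *ₚ (g +ₚ h)) n ≈ coeff (f *ₚ g) n + coeff (f *ₚ h) n
    *ₚ-distribˡ-at [] g h n = sym (+-identityʳ 0#)
    *ₚ-distribˡ-at (a ∷ f) g h zero = begin
      coeff ((a ∷ f) *ₚ (g +ₚ h)) 0         ≈⟨ coeff-*-zero a f (g +ₚ h) ⟩
      a * coeff (g +ₚ h) 0                  ≈⟨ *-congˡ (coeff-+ g h 0) ⟩
      a * (coeff g 0 + coeff h 0)           ≈⟨ distribˡ a _ _ ⟩
      a * coeff g 0 + a * coeff h 0         ≈⟨ +-cong (coeff-*-zero a f g) (coeff-*-zero a f h) ⟨
      coeff ((a ∷ f) *ₚ g) 0 + coeff ((a ∷ f) *ₚ h) 0 ∎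
    *ₚ-distribˡ-at (a ∷ f) g h (suc n) = begin
      coeff ((a ∷ f) *ₚ (g +ₚ h)) (suc n)
        ≈⟨ coeff-*-suc a f (g +ₚ h) n ⟩
      a * coeff (g +ₚ h) (suc n) + coeff (f *ₚ (g +ₚ h)) n
        ≈⟨ +-cong (trans (*-congˡ (coeff-+ g h (suc n))) (distribˡ a _ _)) (*ₚ-distribˡ-at f g h n) ⟩
      (a * coeff g (suc n) + a * coeff h (suc n)) + (coeff (f *ₚ g) n + coeff (f *ₚ h) n)
        ≈⟨ +-interchange _ _ _ _ ⟩
      (a * coeff g (suc n) + coeff (f *ₚ g) n) + (a * coeff h (suc n) + coeff (f *ₚ h) n)
        ≈⟨ +-cong (coeff-*-suc a f g n) (coeff-*-suc a f h n) ⟨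
      coeff ((a ∷ f) *ₚ g) (suc n) + coeff ((a ∷ f) *ₚ h) (suc n) ∎

    *ₚ-distribˡ : ∀ f g h → f *ₚ (g +ₚ h) ≈ₚ f *ₚ g +ₚ f *ₚ h
    *ₚ-distribˡ f g h .at n = trans (*ₚ-distribˡ-at f g h n) (sym (coeff-+ (f *ₚ g) (f *ₚ h) n))

    *ₚ-distribʳ : ∀ h f g → (f +ₚ g) *ₚ h ≈ₚ f *ₚ h +ₚ g *ₚ h
    *ₚ-distribʳ h f g = ≈ₚ-trans (*ₚ-comm (f +ₚ g) h)
      (≈ₚ-trans (*ₚ-distribˡ h f g) (+ₚ-cong (*ₚ-comm h f) (*ₚ-comm h g)))

    scale-*ₚ : ∀ a g h n → coeff (map (a *_) g *ₚ h) n ≈ a * coeff (g *ₚ h) n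
    scale-*ₚ a []      h n = sym (zeroʳ a)
    scale-*ₚ a (b ∷ g) h zero =
      trans (coeff-*-zero (a * b) (map (a *_) g) h) (trans (*-assoc a b _) (*-congˡ (sym (coeff-*-zero b g h))))
    scale-*ₚ a (b ∷ g) h (suc n) = begin
      coeff (map (a *_) (b ∷ g) *ₚ h) (suc n)               ≈⟨ coeff-*-suc (a * b) (map (a *_) g) h n ⟩
      a * b * coeff h (suc n) + coeff (map (a *_) g *ₚ h) n ≈⟨ +-cong (*-assoc a b _) (scale-*ₚ a g h n) ⟩
      a * (b * coeff h (suc n)) + a * coeff (g *ₚ h) n      ≈⟨ distribˡ a _ _ ⟨
      a * (b * coeff h (suc n) + coeff (g *ₚ h) n)          ≈⟨ *-congˡ (coeff-*-suc b g h n) ⟨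
      a * coeff ((b ∷ g) *ₚ h) (suc n)                      ∎

    shift-*ₚ : ∀ f h → (0# ∷ f) *ₚ h ≈ₚ 0# ∷ f *ₚ h
    shift-*ₚ f h .at zero    = trans (coeff-*-zero 0# f h) (zeroˡ _)
    shift-*ₚ f h .at (suc n) = trans (coeff-*-suc 0# f h n) (trans (+-congʳ (zeroˡ _)) (+-identityˡ _))

    *ₚ-assoc-at : ∀ f g h n → coeff ((f *ₚ g) *ₚ h) n ≈ coeff (f *ₚ (g *ₚ h)) n
    *ₚ-assoc-at []      g h n = refl
    *ₚ-assoc-at (a ∷ f) g h n = begin
      coeff ((map (a *_) g +ₚ (0# ∷ f *ₚ g)) *ₚ h) n
        ≈⟨ at (*ₚ-distribʳ h (map (a *_) g) (0# ∷ f *ₚ g)) n ⟩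
      coeff (map (a *_) g *ₚ h +ₚ (0# ∷ f *ₚ g) *ₚ h) n
        ≈⟨ coeff-+ (map (a *_) g *ₚ h) _ n ⟩
      coeff (map (a *_) g *ₚ h) n + coeff ((0# ∷ f *ₚ g) *ₚ h) n
        ≈⟨ +-cong (scale-*ₚ a g h n) (at (shift-*ₚ (f *ₚ g) h) n) ⟩
      a * coeff (g *ₚ h) n + coeff (0# ∷ (f *ₚ g) *ₚ h) n
        ≈⟨ +-cong (sym (coeff-scale a (g *ₚ h) n)) (assoc-shift n) ⟩
      coeff (map (a *_) (g *ₚ h)) n + coeff (0# ∷ f *ₚ (g *ₚ h)) n
        ≈⟨ coeff-+ (map (a *_) (g *ₚ h)) _ n ⟨
      coeff ((a ∷ f) *ₚ (g *ₚ h)) n ∎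
      where
      assoc-shift : ∀ n → coeff (0# ∷ (f *ₚ g) *ₚ h) n ≈ coeff (0# ∷ f *ₚ (g *ₚ h)) n
      assoc-shift zero    = refl
      assoc-shift (suc n) = *ₚ-assoc-at f g h n

  constₚ-* : ∀ a g → (a ∷ []) *ₚ g ≈ₚ map (a *_) g
  constₚ-* a g .at zero    = trans (coeff-*-zero a [] g) (sym (coeff-scale a g 0))
  constₚ-* a g .at (suc n) =
    trans (coeff-*-suc a [] g n) (trans (+-identityʳ _) (sym (coeff-scale a g (suc n))))

  private
    *ₚ-identityˡ : ∀ g → (1# ∷ []) *ₚ g ≈ₚ g
    *ₚ-identityˡ g .at n = trans (at (constₚ-* 1# g) n) (trans (coeff-scale 1# g n) (*-identityˡ _))

  polyRing : CommutativeRing c ℓ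
  polyRing = record
    { Carrier = Poly ; _≈_ = _≈ₚ_ ; _+_ = _+ₚ_ ; _*_ = _*ₚ_ ; -_ = negₚ ; 0# = [] ; 1# = 1# ∷ []
    ; isCommutativeRing = record
      { isRing = record
        { +-isAbelianGroup = record
          { isGroup = record
            { isMonoid = record
              { isSemigroup = record
                { isMagma = record
                  { isEquivalence = record
                    { refl  = mk≈ λ _ → refl
                    ; sym   = λ p → mk≈ λ n → sym (at p n)
                    ; trans = ≈ₚ-trans }
                  ; ∙-cong = +ₚ-cong }
                ; assoc = +ₚ-assoc }
              ; identity = (λ _ → mk≈ λ _ → refl) , +ₚ-identityʳ }
            ; inverse = negₚ-inverseˡ
                      , (λ f → ≈ₚ-trans (+ₚ-comm f (negₚ f)) (negₚ-inverseˡ f))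
            ; ⁻¹-cong = negₚ-cong }
          ; comm = +ₚ-comm }
        ; *-cong = *ₚ-cong
        ; *-assoc = λ f g h → mk≈ (*ₚ-assoc-at f g h)
        ; *-identity = *ₚ-identityˡ , (λ f → ≈ₚ-trans (*ₚ-comm f (1# ∷ [])) (*ₚ-identityˡ f))
        ; distrib = *ₚ-distribˡ , *ₚ-distribʳ }
      ; *-comm = *ₚ-comm } }

-- Ring homomorphisms and evaluation

∣_∣ : ∀ {c ℓ} → CommutativeRing c ℓ → Set c
∣ R ∣ = CommutativeRing.Carrier R

record Hom {c ℓ} (R S : CommutativeRing c ℓ) : Set (c ⊔ ℓ) where
  private
    module R = CommutativeRing R
    module S = CommutativeRing S
  field
    fun    : ∣ R ∣ → ∣ S ∣
    cong   : ∀ {x y} → x R.≈ y → fun x S.≈ fun y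
    0-homo : fun R.0# S.≈ S.0#
    1-homo : fun R.1# S.≈ S.1#
    +-homo : ∀ x y → fun (x R.+ y) S.≈ fun x S.+ fun y
    *-homo : ∀ x y → fun (x R.* y) S.≈ fun x S.* fun y
open Hom public using (fun)

idʰ : ∀ {c ℓ} {R : CommutativeRing c ℓ} → Hom R R
idʰ {R = R} = record
  { fun = λ x → x ; cong = λ p → p ; 0-homo = refl ; 1-homo = refl
  ; +-homo = λ _ _ → refl ; *-homo = λ _ _ → refl }
  where open CommutativeRing R

_∘ʰ_ : ∀ {c ℓ} {R S T : CommutativeRing c ℓ} → Hom S T → Hom R S → Hom R T
_∘ʰ_ {T = T} ψ φ = record
  { fun = fun ψ ∘ fun φ ; cong = ψ.cong ∘ φ.cong
  ; 0-homo = trans (ψ.cong φ.0-homo) ψ.0-homo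
  ; 1-homo = trans (ψ.cong φ.1-homo) ψ.1-homo
  ; +-homo = λ x y → trans (ψ.cong (φ.+-homo x y)) (ψ.+-homo _ _)
  ; *-homo = λ x y → trans (ψ.cong (φ.*-homo x y)) (ψ.*-homo _ _) }
  where
  open CommutativeRing T
  module ψ = Hom ψ
  module φ = Hom φ

constₚ : ∀ {c ℓ} {R : CommutativeRing c ℓ} → Hom R (Polynomials.polyRing R)
constₚ {R = R} = record
  { fun = _∷ []
  ; cong = λ p → mk≈ λ { zero → p ; (suc _) → refl }
  ; 0-homo = mk≈ λ { zero → refl ; (suc _) → refl }
  ; 1-homo = mk≈ λ _ → refl
  ; +-homo = λ _ _ → mk≈ λ _ → refl
  ; *-homo = λ _ _ → mk≈ λ { zero → sym (+-identityʳ _) ; (suc _) → refl } }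
  where
  open CommutativeRing R hiding (zero)
  open Polynomials R

module Evaluation {c ℓ} {R S : CommutativeRing c ℓ} (φ : Hom R S) (s : ∣ S ∣) where
  private
    module R = CommutativeRing R
    module φ = Hom φ
  open CommutativeRing S hiding (zero)
  open Polynomials R
  open CommutativeSemigroupProperties +-commutativeSemigroup
    using () renaming (interchange to +-interchange)
  open CommutativeSemigroupProperties *-commutativeSemigroup
    using () renaming (x∙yz≈y∙xz to x*yz≈y*xz)
  open SetoidReasoning setoid

  eval : Poly → Carrier
  eval []      = 0#
  eval (a ∷ f) = φ.fun a + s * eval f

  private
    -- Equal polynomials may be lists of different lengths; the surplus entries must evaluate to
    -- zero for evaluation to respect equality.
    eval-zero : ∀ f → f ≈ₚ [] → eval f ≈ 0#
    eval-zero []      p = refl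
    eval-zero (a ∷ f) p = begin
      φ.fun a + s * eval f ≈⟨ +-cong (trans (φ.cong (at p 0)) φ.0-homo)
                                     (*-congˡ (eval-zero f (mk≈ (at p ∘ suc)))) ⟩
      0# + s * 0#          ≈⟨ trans (+-identityˡ _) (zeroʳ s) ⟩
      0#                   ∎

    eval-cong : ∀ f g → f ≈ₚ g → eval f ≈ eval g
    eval-cong []      g       p = sym (eval-zero g (mk≈ (R.sym ∘ at p)))
    eval-cong (a ∷ f) []      p = eval-zero (a ∷ f) p
    eval-cong (a ∷ f) (b ∷ g) p =
      +-cong (φ.cong (at p 0)) (*-congˡ (eval-cong f g (mk≈ (at p ∘ suc))))

    eval-+ : ∀ f g → eval (f +ₚ g) ≈ eval f + eval g
    eval-+ []      g       = sym (+-identityˡ _)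
    eval-+ (a ∷ f) []      = sym (+-identityʳ _)
    eval-+ (a ∷ f) (b ∷ g) = begin
      φ.fun (a R.+ b) + s * eval (f +ₚ g)
        ≈⟨ +-cong (φ.+-homo a b) (trans (*-congˡ (eval-+ f g)) (distribˡ s _ _)) ⟩
      (φ.fun a + φ.fun b) + (s * eval f + s * eval g)
        ≈⟨ +-interchange _ _ _ _ ⟩
      (φ.fun a + s * eval f) + (φ.fun b + s * eval g) ∎

    eval-scale : ∀ a g → eval (map (a R.*_) g) ≈ φ.fun a * eval g
    eval-scale a []      = sym (zeroʳ _)
    eval-scale a (b ∷ g) = begin
      φ.fun (a R.* b) + s * eval (map (a R.*_) g)
        ≈⟨ +-cong (φ.*-homo a b) (*-congˡ (eval-scale a g)) ⟩
      φ.fun a * φ.fun b + s * (φ.fun a * eval g)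
        ≈⟨ +-congˡ (x*yz≈y*xz s _ _) ⟩
      φ.fun a * φ.fun b + φ.fun a * (s * eval g)
        ≈⟨ distribˡ _ _ _ ⟨
      φ.fun a * (φ.fun b + s * eval g) ∎

    eval-* : ∀ f g → eval (f *ₚ g) ≈ eval f * eval g
    eval-* []      g = sym (zeroˡ _)
    eval-* (a ∷ f) g = begin
      eval (map (a R.*_) g +ₚ (R.0# ∷ f *ₚ g))
        ≈⟨ eval-+ (map (a R.*_) g) _ ⟩
      eval (map (a R.*_) g) + (φ.fun R.0# + s * eval (f *ₚ g))
        ≈⟨ +-cong (eval-scale a g) (trans (+-congʳ φ.0-homo) (+-identityˡ _)) ⟩
      φ.fun a * eval g + s * eval (f *ₚ g)
        ≈⟨ +-congˡ (trans (*-congˡ (eval-* f g)) (sym (*-assoc s _ _))) ⟩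
      φ.fun a * eval g + s * eval f * eval g
        ≈⟨ distribʳ _ _ _ ⟨
      (φ.fun a + s * eval f) * eval g ∎

  evalʰ : Hom polyRing S
  evalʰ = record
    { fun = eval ; cong = λ {f} {g} → eval-cong f g ; 0-homo = refl
    ; 1-homo = trans (+-cong φ.1-homo (zeroʳ s)) (+-identityʳ _)
    ; +-homo = eval-+ ; *-homo = eval-* }
open Evaluation public using (eval; evalʰ)

-- Polynomials in k variables, as an iterated polynomial ring

MP : ∀ {c ℓ} → CommutativeRing c ℓ → ℕ → CommutativeRing c ℓ
MP R zero    = R
MP R (suc k) = Polynomials.polyRing (MP R k)

constʰ : ∀ {c ℓ} {R : CommutativeRing c ℓ} k → Hom R (MP R k)
constʰ zero    = idʰ
constʰ {R = R} (suc k) = constₚ {R = MP R k} ∘ʰ constʰ k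

var : ∀ {c ℓ} (R : CommutativeRing c ℓ) k → Fin k → ∣ MP R k ∣
var R (suc k) zero    = CommutativeRing.0# (MP R k) ∷ CommutativeRing.1# (MP R k) ∷ []
var R (suc k) (suc i) = fun (constₚ {R = MP R k}) (var R k i)

evʰ : ∀ {c ℓ} {R S : CommutativeRing c ℓ} k → Hom R S → (Fin k → ∣ S ∣) → Hom (MP R k) S
evʰ zero    φ r = φ
evʰ (suc k) φ r = evalʰ (evʰ k φ (r ∘ suc)) (r zero)

ev : ∀ {c ℓ} {R S : CommutativeRing c ℓ} k → Hom R S → (Fin k → ∣ S ∣) → ∣ MP R k ∣ → ∣ S ∣
ev k φ r = fun (evʰ k φ r)

module _ {c ℓ} {R S : CommutativeRing c ℓ} where
  private module R = CommutativeRing R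
  open CommutativeRing S hiding (zero)

  ev-const : ∀ k (φ : Hom R S) r x → ev k φ r (fun (constʰ k) x) ≈ fun φ x
  ev-const zero    φ r x = refl
  ev-const (suc k) φ r x =
    trans (+-cong (ev-const k φ (r ∘ suc) x) (zeroʳ _)) (+-identityʳ _)

  ev-var : ∀ k (φ : Hom R S) r i → ev k φ r (var R k i) ≈ r i
  ev-var (suc k) φ r zero = trans
    (+-cong (Hom.0-homo (evʰ k φ (r ∘ suc)))
      (*-congˡ (trans (+-cong (Hom.1-homo (evʰ k φ (r ∘ suc))) (zeroʳ _)) (+-identityʳ _))))
    (trans (+-identityˡ _) (*-identityʳ _))
  ev-var (suc k) φ r (suc i) =
    trans (+-cong (ev-var k φ (r ∘ suc) i) (zeroʳ _)) (+-identityʳ _)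

  ev-cong : ∀ k (φ ψ : Hom R S) {r s} → (∀ x → fun φ x ≈ fun ψ x) → (∀ i → r i ≈ s i) →
            ∀ P → ev k φ r P ≈ ev k ψ s P
  ev-cong zero    φ ψ φ≈ψ r≈s P = φ≈ψ P
  ev-cong (suc k) φ ψ φ≈ψ r≈s []      = refl
  ev-cong (suc k) φ ψ φ≈ψ r≈s (a ∷ f) =
    +-cong (ev-cong k φ ψ φ≈ψ (r≈s ∘ suc) a) (*-cong (r≈s zero) (ev-cong (suc k) φ ψ φ≈ψ r≈s f))

ev-natural : ∀ {c ℓ} {R S T : CommutativeRing c ℓ} k (ψ : Hom S T) (φ : Hom R S) r P →
  CommutativeRing._≈_ T (fun ψ (ev k φ r P)) (ev k (ψ ∘ʰ φ) (fun ψ ∘ r) P)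
ev-natural {T = T} zero ψ φ r P = CommutativeRing.refl T
ev-natural (suc k) ψ φ r [] = Hom.0-homo ψ
ev-natural {T = T} (suc k) ψ φ r (a ∷ f) =
  trans (Hom.+-homo ψ _ _)
    (+-cong (ev-natural k ψ φ (r ∘ suc) a)
      (trans (Hom.*-homo ψ _ _) (*-congˡ (ev-natural (suc k) ψ φ r f))))
  where open CommutativeRing T

-- Evaluation at the generic point. Together with naturality it turns a statement about values over
-- every ring into one about the polynomial itself.
ev-identity : ∀ {c ℓ} {R : CommutativeRing c ℓ} k P →
  CommutativeRing._≈_ (MP R k) (ev k (constʰ k) (var R k) P) P
ev-identity {R = R} zero P = CommutativeRing.refl R
ev-identity {R = R} (suc k) = go
  where
  open CommutativeRing (MP R (suc k)) hiding (zero)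
  open Polynomials (MP R k)
  module M = CommutativeRing (MP R k)
  go : ∀ f → ev (suc k) (constʰ (suc k)) (var R (suc k)) f ≈ f
  go []      = refl
  go (a ∷ f) = trans
    (+-cong
      (trans (sym (ev-natural k constₚ (constʰ k) (var R k) a))
        (Hom.cong constₚ (ev-identity k a)))
      (*-congˡ {x = var R (suc k) zero} (go f)))
    (mk≈ λ
      { zero → M.trans (coeff-+ (a ∷ []) (var R (suc k) zero *ₚ f) 0)
          (M.trans (M.+-congˡ (M.trans (coeff-*-zero M.0# (M.1# ∷ []) f) (M.zeroˡ _))) (M.+-identityʳ _))
      ; (suc n) → M.trans (coeff-+ (a ∷ []) (var R (suc k) zero *ₚ f) (suc n))
          (M.trans (M.+-identityˡ _)
          (M.trans (coeff-*-suc M.0# (M.1# ∷ []) f n)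
          (M.trans (M.+-cong (M.zeroˡ _) (at (*-identityˡ f) n)) (M.+-identityˡ _)))) })

-- Filtrations and the coefficients of polynomials

bump : ∀ {k} → Vec ℕ (suc k) → Vec ℕ (suc k)
bump (a ∷ α) = suc a ∷ α

unit : ∀ {k} → Fin k → Vec ℕ k
unit zero    = 1 ∷ replicate _ 0
unit (suc i) = 0 ∷ unit i

record IsSubmonoid {c ℓ p} (S : CommutativeRing c ℓ) (W : ∣ S ∣ → Set p) : Set (c ⊔ ℓ ⊔ p) where
  open CommutativeRing S
  field
    resp : ∀ {x y} → x ≈ y → W x → W y
    0∈   : W 0#
    +∈   : ∀ {x y} → W x → W y → W (x + y)

module Monomials {c ℓ} (S : CommutativeRing c ℓ) where
  open CommutativeRing S hiding (zero)

  pow : Carrier → ℕ → Carrier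
  pow s zero    = 1#
  pow s (suc n) = s * pow s n

  monomial : ∀ {k} → (Fin k → Carrier) → Vec ℕ k → Carrier
  monomial r []      = 1#
  monomial r (n ∷ α) = pow (r zero) n * monomial (r ∘ suc) α

dot : ∀ {k} → (Fin k → ℕ) → Vec ℕ k → ℕ
dot w []      = 0
dot w (n ∷ α) = n ℕ.* w zero ℕ.+ dot (w ∘ suc) α

-- No monotonicity in v: both orders of vanishing (decreasing) and degrees (increasing) are instances.
record Filtration {c ℓ} p (S : CommutativeRing c ℓ) : Set (c ⊔ ℓ ⊔ lsuc p) where
  open CommutativeRing S hiding (zero)
  open Monomials S
  field
    V     : ℕ → Carrier → Set p
    isSub : ∀ v → IsSubmonoid S (V v)
    1∈    : V 0 1#
    *∈    : ∀ {u v x y} → V u x → V v y → V (u ℕ.+ v) (x * y)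

  pow∈ : ∀ {v x} → V v x → ∀ n → V (n ℕ.* v) (pow x n)
  pow∈ h zero    = 1∈
  pow∈ h (suc n) = *∈ h (pow∈ h n)

  monomial∈ : ∀ {k} (w : Fin k → ℕ) {r} → (∀ i → V (w i) (r i)) → ∀ α → V (dot w α) (monomial r α)
  monomial∈ w h []      = 1∈
  monomial∈ w h (n ∷ α) = *∈ (pow∈ (h zero) n) (monomial∈ (w ∘ suc) (h ∘ suc) α)

module Coefficients {c ℓ} (R : CommutativeRing c ℓ) where
  open CommutativeRing R hiding (zero)

  coef : ∀ k → ∣ MP R k ∣ → Vec ℕ k → Carrier
  coef zero    x []      = x
  coef (suc k) f (n ∷ α) = coef k (Polynomials.coeff (MP R k) f n) α

  coef-cong : ∀ k {P Q} → CommutativeRing._≈_ (MP R k) P Q → ∀ α → coef k P α ≈ coef k Q α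
  coef-cong zero    p []      = p
  coef-cong (suc k) p (n ∷ α) = coef-cong k (Polynomials.at p n) α

  coef-ext : ∀ k {P Q} → (∀ α → coef k P α ≈ coef k Q α) → CommutativeRing._≈_ (MP R k) P Q
  coef-ext zero    p = p []
  coef-ext (suc k) p = Polynomials.mk≈ λ n → coef-ext k (p ∘ (n ∷_))

  coef-0 : ∀ k α → coef k (CommutativeRing.0# (MP R k)) α ≈ 0#
  coef-0 zero    []      = refl
  coef-0 (suc k) (n ∷ α) = coef-0 k α

  coef-+ : ∀ k P Q α → coef k (CommutativeRing._+_ (MP R k) P Q) α ≈ coef k P α + coef k Q α
  coef-+ zero    P Q []      = refl
  coef-+ (suc k) P Q (n ∷ α) =
    trans (coef-cong k (Polynomials.coeff-+ (MP R k) P Q n) α) (coef-+ k _ _ α)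

  coef-scale : ∀ k x P α →
    coef k (CommutativeRing._*_ (MP R k) (fun (constʰ k) x) P) α ≈ x * coef k P α
  coef-scale zero    x P []      = refl
  coef-scale (suc k) x P (n ∷ α) = trans
    (coef-cong k (CommutativeRing.trans (MP R k)
      (at (constₚ-* (fun (constʰ k) x) P) n) (coeff-scale (fun (constʰ k) x) P n)) α)
    (coef-scale k x _ α)
    where open Polynomials (MP R k)

  -- The coefficient of a product at `γ` is a sum of products of coefficients whose exponents add up
  -- to `γ`. The induction transports the predicates and never writes this convolution out: dropping
  -- the first coefficient of the left factor shifts `A` and `C` by `bump`.
  coef-*-∈ : ∀ {p} k {A B C : Vec ℕ k → Carrier → Set p} → (∀ γ → IsSubmonoid R (C γ)) →
    (∀ {α β x y} → A α x → B β y → C (zipWith ℕ._+_ α β) (x * y)) →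
    ∀ P Q → (∀ α → A α (coef k P α)) → (∀ β → B β (coef k Q β)) →
    ∀ γ → C γ (coef k (CommutativeRing._*_ (MP R k) P Q) γ)
  coef-*-∈ zero sub mul P Q hP hQ [] = mul (hP []) (hQ [])
  coef-*-∈ {p} (suc k) {B = B} sub mul P Q hP hQ = go P sub mul hP
    where
    open Polynomials (MP R k)
    go : ∀ f {A C : Vec ℕ (suc k) → Carrier → Set p} → (∀ γ → IsSubmonoid R (C γ)) →
         (∀ {α β x y} → A α x → B β y → C (zipWith ℕ._+_ α β) (x * y)) →
         (∀ α → A α (coef (suc k) f α)) → ∀ γ → C γ (coef (suc k) (f *ₚ Q) γ)
    go [] sub mul hf (n ∷ γ) = IsSubmonoid.resp (sub _) (sym (coef-0 k γ)) (IsSubmonoid.0∈ (sub _))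
    go (a ∷ f) sub mul hf (zero ∷ γ) = IsSubmonoid.resp (sub _)
      (sym (coef-cong k (coeff-*-zero a f Q) γ))
      (coef-*-∈ k (sub ∘ (0 ∷_)) mul a _ (hf ∘ (0 ∷_)) (hQ ∘ (0 ∷_)) γ)
    go (a ∷ f) {A} {C} sub mul hf (suc n ∷ γ) = IsSubmonoid.resp (sub _)
      (sym (trans (coef-cong k (coeff-*-suc a f Q n) γ) (coef-+ k _ _ γ)))
      (IsSubmonoid.+∈ (sub _)
        (coef-*-∈ k (sub ∘ (suc n ∷_)) mul a _ (hf ∘ (0 ∷_)) (hQ ∘ (suc n ∷_)) γ)
        (go f {A ∘ bump} {C ∘ bump} (sub ∘ bump) (λ { {_ ∷ _} {_ ∷ _} → mul })
          (λ { (i ∷ δ) → hf (suc i ∷ δ) }) (n ∷ γ)))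

  coef-const-∈ : ∀ {p} k {A : Vec ℕ k → Carrier → Set p} → (∀ α → IsSubmonoid R (A α)) →
    ∀ {x} → A (replicate k 0) x → ∀ α → A α (coef k (fun (constʰ k) x) α)
  coef-const-∈ zero    sub h []          = h
  coef-const-∈ (suc k) sub h (zero  ∷ α) = coef-const-∈ k (sub ∘ (0 ∷_)) h α
  coef-const-∈ (suc k) sub h (suc n ∷ α) =
    IsSubmonoid.resp (sub _) (sym (coef-0 k α)) (IsSubmonoid.0∈ (sub _))

  coef-var-∈ : ∀ {p} k {A : Vec ℕ k → Carrier → Set p} → (∀ α → IsSubmonoid R (A α)) →
    ∀ i → A (unit i) 1# → ∀ α → A α (coef k (var R k i) α)
  coef-var-∈ (suc k) sub zero h (zero ∷ α) =
    IsSubmonoid.resp (sub _) (sym (coef-0 k α)) (IsSubmonoid.0∈ (sub _))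
  coef-var-∈ (suc k) sub zero h (suc zero ∷ α) = IsSubmonoid.resp (sub _)
    (coef-cong k (Hom.1-homo (constʰ k)) α) (coef-const-∈ k (sub ∘ (1 ∷_)) h α)
  coef-var-∈ (suc k) sub zero h (suc (suc n) ∷ α) =
    IsSubmonoid.resp (sub _) (sym (coef-0 k α)) (IsSubmonoid.0∈ (sub _))
  coef-var-∈ (suc k) sub (suc i) h (zero  ∷ α) = coef-var-∈ k (sub ∘ (0 ∷_)) i h α
  coef-var-∈ (suc k) sub (suc i) h (suc n ∷ α) =
    IsSubmonoid.resp (sub _) (sym (coef-0 k α)) (IsSubmonoid.0∈ (sub _))

  -- The common source of the filtrations on polynomial rings: total degree, weighted order, and a
  -- filtration of the base ring applied to each coefficient.
  coefFiltration : ∀ {p} k (A : ℕ → Vec ℕ k → Carrier → Set p) →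
    (∀ v α → IsSubmonoid R (A v α)) →
    A 0 (replicate k 0) 1# →
    (∀ {u v α β x y} → A u α x → A v β y → A (u ℕ.+ v) (zipWith ℕ._+_ α β) (x * y)) →
    Filtration p (MP R k)
  coefFiltration k A sub one mul = record
    { V = λ v P → ∀ α → A v α (coef k P α)
    ; isSub = λ v → record
      { resp = λ p h α → IsSubmonoid.resp (sub v α) (coef-cong k p α) (h α)
      ; 0∈ = λ α → IsSubmonoid.resp (sub v α) (sym (coef-0 k α)) (IsSubmonoid.0∈ (sub v α))
      ; +∈ = λ hP hQ α → IsSubmonoid.resp (sub v α) (sym (coef-+ k _ _ α))
               (IsSubmonoid.+∈ (sub v α) (hP α) (hQ α)) }
    ; 1∈ = λ α → IsSubmonoid.resp (sub 0 α) (coef-cong k (Hom.1-homo (constʰ k)) α)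
             (coef-const-∈ k (sub 0) one α)
    ; *∈ = λ {u} {v} {P} {Q} → coef-*-∈ k (sub (u ℕ.+ v)) mul P Q }

module _ {c ℓ} {S : CommutativeRing c ℓ} where
  open CommutativeRing S hiding (zero)
  open Monomials S
  open CommutativeSemigroupProperties *-commutativeSemigroup
    using (x∙yz≈y∙xz)

  -- The value is the sum of the terms, so an additive submonoid containing every term contains it.
  -- The induction follows Horner's scheme: a factor `r zero` is absorbed by passing to the
  -- submonoid of those `x` with `r zero * x` in `W`.
  ev-∈ : ∀ {p} {R : CommutativeRing c ℓ} k (φ : Hom R S) (r : Fin k → Carrier) {W : Carrier → Set p} →
    IsSubmonoid S W → ∀ P → (∀ α → W (fun φ (Coefficients.coef R k P α) * monomial r α)) → W (ev k φ r P)
  ev-∈ zero φ r sub P h = IsSubmonoid.resp sub (*-identityʳ _) (h [])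
  ev-∈ {p} {R} (suc k) φ r sub P h = go P sub λ n α → h (n ∷ α)
    where
    go : ∀ f {W : Carrier → Set p} → IsSubmonoid S W →
         (∀ n α → W (fun φ (Coefficients.coef R k (Polynomials.coeff (MP R k) f n) α)
                     * (pow (r zero) n * monomial (r ∘ suc) α))) →
         W (ev (suc k) φ r f)
    go []      sub h = IsSubmonoid.0∈ sub
    go (a ∷ f) {W} sub h = +∈
      (ev-∈ k φ (r ∘ suc) sub a λ α → resp (*-congˡ (*-identityˡ _)) (h 0 α))
      (go f {λ x → W (r zero * x)} shifted
        λ n α → resp (trans (*-congˡ (*-assoc _ _ _)) (x∙yz≈y∙xz _ _ _)) (h (suc n) α))
      where
      open IsSubmonoid sub
      shifted : IsSubmonoid S (λ x → W (r zero * x))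
      shifted = record
        { resp = resp ∘ *-congˡ ; 0∈ = resp (sym (zeroʳ _)) 0∈
        ; +∈ = λ x y → resp (sym (distribˡ _ _ _)) (+∈ x y) }

dot-zipWith : ∀ {k} (w : Fin k → ℕ) α β → dot w (zipWith ℕ._+_ α β) ≡ dot w α ℕ.+ dot w β
dot-zipWith w []      []      = ≡.refl
dot-zipWith w (m ∷ α) (n ∷ β) = ≡.trans
  (≡.cong₂ ℕ._+_ (ℕ.*-distribʳ-+ (w zero) m n) (dot-zipWith (w ∘ suc) α β))
  (CommutativeSemigroupProperties.interchange ℕ.+-commutativeSemigroup (m ℕ.* w zero) _ _ _)

dot-zero : ∀ {k} (w : Fin k → ℕ) → dot w (replicate k 0) ≡ 0
dot-zero {zero}  w = ≡.refl
dot-zero {suc k} w = dot-zero (w ∘ suc)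

dot-unit : ∀ {k} (w : Fin k → ℕ) i → dot w (unit i) ≡ w i
dot-unit w zero    = ≡.trans (≡.cong (w zero ℕ.+ 0 ℕ.+_) (dot-zero (w ∘ suc)))
  (≡.trans (ℕ.+-identityʳ _) (ℕ.+-identityʳ _))
dot-unit w (suc i) = dot-unit (w ∘ suc) i

degree : ∀ {k} → Vec ℕ k → ℕ
degree = dot (λ _ → 1)

∸-subadditive : ∀ u v a b → (u ℕ.+ v) ℕ.∸ (a ℕ.+ b) ℕ.≤ (u ℕ.∸ a) ℕ.+ (v ℕ.∸ b)
∸-subadditive u v a b = ℕ.m≤n+o⇒m∸n≤o (u ℕ.+ v) (a ℕ.+ b) (ℕ.≤-trans
  (ℕ.+-mono-≤ (ℕ.m≤n+m∸n u a) (ℕ.m≤n+m∸n v b))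
  (ℕ.≤-reflexive (CommutativeSemigroupProperties.interchange ℕ.+-commutativeSemigroup a _ b _)))

+-positive : ∀ u {v} → 0 ℕ.< u ℕ.+ v → 0 ℕ.< u ⊎ 0 ℕ.< v
+-positive zero    h = inj₂ h
+-positive (suc u) h = inj₁ (s≤s z≤n)

module _ {c ℓ p} {R : CommutativeRing c ℓ} (𝓕 : Filtration p R) where
  open CommutativeRing R hiding (zero)
  open Filtration 𝓕
  open Coefficients R

  Antitone : Set (c ⊔ p)
  Antitone = ∀ {u v x} → u ℕ.≤ v → V v x → V u x

  -- A term reaches level `v` if its weight together with the level of its coefficient does. Over
  -- `trivialFiltration` only the weight counts, and the level is an order of vanishing. Over the
  -- filtration by powers of t - τ, with all weights 1, it is the order at the point t = τ where all
  -- variables vanish.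
  weighted : Antitone → ∀ k (w : Fin k → ℕ) → Filtration p (MP R k)
  weighted anti k w = coefFiltration k (λ v α → V (v ℕ.∸ dot w α)) (λ v α → isSub _)
    (≡.subst (λ n → V n 1#) (≡.sym (ℕ.0∸n≡0 (dot w (replicate k 0)))) 1∈)
    (λ {u} {v} {α} {β} x y → anti
      (≡.subst (λ n → (u ℕ.+ v) ℕ.∸ n ℕ.≤ (u ℕ.∸ dot w α) ℕ.+ (v ℕ.∸ dot w β))
        (≡.sym (dot-zipWith w α β)) (∸-subadditive u v (dot w α) (dot w β)))
      (*∈ x y))

  module _ (anti : Antitone) k (w : Fin k → ℕ) where
    private module W = Filtration (weighted anti k w)

    weighted-anti : ∀ {u v P} → u ℕ.≤ v → W.V v P → W.V u P
    weighted-anti u≤v h α = anti (ℕ.∸-monoˡ-≤ (dot w α) u≤v) (h α)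

    weighted-const : ∀ {v x} → V v x → W.V v (fun (constʰ k) x)
    weighted-const {v} {x} h = coef-const-∈ k (λ α → isSub _)
      (≡.subst (λ n → V (v ℕ.∸ n) x) (≡.sym (dot-zero w)) h)

    weighted-var : ∀ i → W.V (w i) (var R k i)
    weighted-var i = coef-var-∈ k (λ α → isSub _) i
      (≡.subst (λ n → V n 1#) (≡.sym (≡.trans (≡.cong (w i ℕ.∸_) (dot-unit w i)) (ℕ.n∸n≡0 (w i)))) 1∈)

  coefficientwise : ∀ k → Filtration p (MP R k)
  coefficientwise k = coefFiltration k (λ v α → V v) (λ v α → isSub v) 1∈ *∈

  sum∈ : ∀ v {n} (x : Fin n → Carrier) → (∀ i → V v (x i)) → V v (SemiringSum.sum semiring x)
  sum∈ v {zero}  x h = IsSubmonoid.0∈ (isSub v)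
  sum∈ v {suc n} x h = IsSubmonoid.+∈ (isSub v) (h zero) (sum∈ v (x ∘ suc) (h ∘ suc))

module _ {c ℓ} (R : CommutativeRing c ℓ) where
  open CommutativeRing R hiding (zero)
  open Monomials R

  conditionallyZero : ∀ {p} (C : Set p) → IsSubmonoid R (λ x → C → x ≈ 0#)
  conditionallyZero C = record
    { resp = λ p h i → trans (sym p) (h i) ; 0∈ = λ _ → refl
    ; +∈ = λ x y i → trans (+-cong (x i) (y i)) (+-identityˡ 0#) }

  trivialFiltration : Filtration ℓ R
  trivialFiltration = record
    { V = λ v x → 0 ℕ.< v → x ≈ 0#
    ; isSub = λ v → conditionallyZero (0 ℕ.< v)
    ; 1∈ = λ ()
    ; *∈ = λ {u} hx hy 0<u+v → case (+-positive u 0<u+v) hx hy }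
    where
    case : ∀ {u v x y} → 0 ℕ.< u ⊎ 0 ℕ.< v → (0 ℕ.< u → x ≈ 0#) → (0 ℕ.< v → y ≈ 0#) → x * y ≈ 0#
    case (inj₁ 0<u) hx hy = trans (*-congʳ (hx 0<u)) (zeroˡ _)
    case (inj₂ 0<v) hx hy = trans (*-congˡ (hy 0<v)) (zeroʳ _)

  trivialFiltration-anti : Antitone trivialFiltration
  trivialFiltration-anti u≤v h 0<u = h (ℕ.≤-trans 0<u u≤v)

  degreeFiltration : ∀ k → Filtration ℓ (MP R k)
  degreeFiltration k = Coefficients.coefFiltration R k (λ v α x → v ℕ.< degree α → x ≈ 0#)
    (λ v α → conditionallyZero (v ℕ.< degree α))
    (λ 0<deg → contra (≡.subst (0 ℕ.<_) (dot-zero {k} (λ _ → 1)) 0<deg))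
    (λ {u} {v} {α} {β} hx hy deg → case (ℕ.<-≤-connex u (degree α)) hx hy
      (≡.subst (u ℕ.+ v ℕ.<_) (dot-zipWith (λ _ → 1) α β) deg))
    where
    contra : ∀ {A : Set ℓ} → 0 ℕ.< 0 → A
    contra ()
    case : ∀ {u v a b x y} → u ℕ.< a ⊎ a ℕ.≤ u → (u ℕ.< a → x ≈ 0#) → (v ℕ.< b → y ≈ 0#) →
           u ℕ.+ v ℕ.< a ℕ.+ b → x * y ≈ 0#
    case (inj₁ u<a) hx hy h = trans (*-congʳ (hx u<a)) (zeroˡ _)
    case {u} {v} {a} {b} (inj₂ a≤u) hx hy h = trans
      (*-congˡ (hy (ℕ.+-cancelˡ-< u v b (ℕ.≤-trans h (ℕ.+-monoˡ-≤ b a≤u))))) (zeroʳ _)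

  Divides : Carrier → ℕ → Carrier → Set (c ⊔ ℓ)
  Divides q n h = ∃[ r ] h ≈ pow q n * r

  pow-+ : ∀ q m n → pow q (m ℕ.+ n) ≈ pow q m * pow q n
  pow-+ q zero    n = sym (*-identityˡ _)
  pow-+ q (suc m) n = trans (*-congˡ (pow-+ q m n)) (sym (*-assoc _ _ _))

  adicFiltration : Carrier → Filtration (c ⊔ ℓ) R
  adicFiltration q = record
    { V = Divides q
    ; isSub = λ v → record
      { resp = λ { p (r , h) → r , trans (sym p) h }
      ; 0∈ = 0# , sym (zeroʳ _)
      ; +∈ = λ { (r , h) (s , k) → r + s , trans (+-cong h k) (sym (distribˡ _ _ _)) } }
    ; 1∈ = 1# , sym (*-identityˡ _)
    ; *∈ = λ { {u} {v} (r , h) (s , k) → r * s ,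
        trans (*-cong h k) (trans (interchange _ _ _ _) (*-congʳ (sym (pow-+ q u v)))) } }
    where open CommutativeSemigroupProperties *-commutativeSemigroup using (interchange)

  adicFiltration-anti : ∀ q → Antitone (adicFiltration q)
  adicFiltration-anti q {u} {v} u≤v (r , h) = pow q (v ℕ.∸ u) * r , trans h
    (trans (*-congʳ (trans (reflexive (≡.cong (pow q) (≡.sym (ℕ.m+[n∸m]≡n u≤v)))) (pow-+ q u (v ℕ.∸ u))))
      (*-assoc _ _ _))

-- Affine substitutions and expansion in a frame

module _ {c ℓ} (S : CommutativeRing c ℓ) where
  open CommutativeRing S hiding (zero)
  open SemiringSum semiring

  sum-++ : ∀ m n (x : Fin (m ℕ.+ n) → Carrier) →
    sum {m ℕ.+ n} x ≈ sum {m} (λ i → x (i ↑ˡ n)) + sum {n} (λ j → x (m ↑ʳ j))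
  sum-++ zero    n x = sym (+-identityˡ _)
  sum-++ (suc m) n x = trans (+-congˡ (sum-++ m n (x ∘ suc))) (sym (+-assoc _ _ _))

module _ {c ℓ} {R S : CommutativeRing c ℓ} (φ : Hom R S) where
  private
    module R = CommutativeRing R
    module S = CommutativeRing S
  hom-sum : ∀ {n} (x : Fin n → ∣ R ∣) →
    fun φ (SemiringSum.sum R.semiring x) S.≈ SemiringSum.sum S.semiring (fun φ ∘ x)
  hom-sum {zero}  x = Hom.0-homo φ
  hom-sum {suc n} x = S.trans (Hom.+-homo φ _ _) (S.+-congˡ (hom-sum (x ∘ suc)))

module _ {c ℓ} {S : CommutativeRing c ℓ} where
  open CommutativeRing S hiding (zero)
  open SemiringSum semiring

  affine : ∀ {R : CommutativeRing c ℓ} {d n} → Hom R S → (Fin d → ∣ R ∣) → (Fin n → Fin d → ∣ R ∣) →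
           (Fin n → Carrier) → Fin d → Carrier
  affine φ o e r j = fun φ (o j) + sum (λ i → r i * fun φ (e i j))

module Expansion {c ℓ} {F : CommutativeRing c ℓ} {d n : ℕ}
  (o : Fin d → ∣ F ∣) (e : Fin n → Fin d → ∣ F ∣) where

  -- The Taylor expansion at `o` along the vectors `e`, obtained by substituting `o` plus a generic
  -- combination of them.
  expansion : Hom (MP F d) (MP F n)
  expansion = evʰ d (constʰ n) (affine (constʰ n) o e (var F n))

  expand : ∣ MP F d ∣ → ∣ MP F n ∣
  expand = fun expansion

  module _ {S : CommutativeRing c ℓ} (φ : Hom F S) (r : Fin n → ∣ S ∣) where
    open CommutativeRing S hiding (zero)
    open SemiringSum semiring

    -- Comparisons of expansions reduce to this: to relate the expansion at `r` to a value of `g` it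
    -- is enough to identify the point with coordinates `r`.
    ev-expand : ∀ {y} → (∀ j → affine {S = S} φ o e r j ≈ y j) →
      ∀ g → ev n φ r (expand g) ≈ ev d φ y g
    ev-expand {y} h g = trans (ev-natural d (evʰ n φ r) (constʰ n) _ g)
      (ev-cong d (evʰ n φ r ∘ʰ constʰ n) φ (ev-const n φ r) (λ j → trans (ev-affine j) (h j)) g)
      where
      module E = Hom (evʰ n φ r)
      open CommutativeRing (MP F n) using () renaming (_*_ to _*ₙ_)
      ev-affine : ∀ j → ev n φ r (affine (constʰ n) o e (var F n) j) ≈ affine φ o e r j
      ev-affine j = trans (E.+-homo _ _) (+-cong (ev-const n φ r (o j))
        (trans (hom-sum (evʰ n φ r) (λ i → var F n i *ₙ fun (constʰ n) (e i j)))
          (sum-cong-≋ {n} λ i → trans (E.*-homo _ _) (*-cong (ev-var n φ r i) (ev-const n φ r (e i j))))))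

module _ {c ℓ} (F : CommutativeRing c ℓ) where
  open CommutativeRing F hiding (zero)
  open SemiringSum semiring

  δ : ∀ {d} → Fin d → Fin d → Carrier
  δ zero    zero    = 1#
  δ zero    (suc j) = 0#
  δ (suc i) zero    = 0#
  δ (suc i) (suc j) = δ i j

  -- Row `j` of `ε` writes the standard basis vector `j` as a combination of the vectors `e`; thus
  -- `ε` is a one-sided inverse of the frame and supplies coordinates for every point.
  IsSpanning : ∀ {d n} → (Fin n → Fin d → Carrier) → (Fin d → Fin n → Carrier) → Set ℓ
  IsSpanning e ε = ∀ j j′ → sum (λ i → ε j i * e i j′) ≈ δ j j′

module _ {c ℓ} {F S : CommutativeRing c ℓ} (φ : Hom F S) where
  open CommutativeRing S hiding (zero)
  open SemiringSum semiring
  open SetoidReasoning setoid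
  private module F = CommutativeRing F

  sum-δ : ∀ {d} (x : Fin d → Carrier) j → sum (λ i → x i * fun φ (δ F i j)) ≈ x j
  sum-δ {suc d} x zero    = trans
    (+-cong (trans (*-congˡ (Hom.1-homo φ)) (*-identityʳ _))
      (trans (sum-cong-≋ {d} λ i → trans (*-congˡ (Hom.0-homo φ)) (zeroʳ _)) (sum-replicate-zero d)))
    (+-identityʳ _)
  sum-δ {suc d} x (suc j) = trans
    (+-cong (trans (*-congˡ (Hom.0-homo φ)) (zeroʳ _)) (sum-δ (x ∘ suc) j)) (+-identityˡ _)

  coordinates : ∀ {d n} → (Fin d → ∣ F ∣) → (Fin d → Fin n → ∣ F ∣) → (Fin d → Carrier) → Fin n → Carrier
  coordinates o ε y i = sum (λ j → (y j - fun φ (o j)) * fun φ (ε j i))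

  affine-coordinates : ∀ {d n} (o : Fin d → ∣ F ∣) (e : Fin n → Fin d → ∣ F ∣) (ε : Fin d → Fin n → ∣ F ∣) →
    IsSpanning F e ε → ∀ y j → affine {S = S} φ o e (coordinates o ε y) j ≈ y j
  affine-coordinates {d} {n} o e ε span y j = begin
    fun φ (o j) + sum {n} (λ i → sum {d} (λ k → x k * fun φ (ε k i)) * fun φ (e i j))
      ≈⟨ +-congˡ (sum-cong-≋ {n} λ i → *-distribʳ-sum {d} (fun φ (e i j)) (λ k → x k * fun φ (ε k i))) ⟩
    fun φ (o j) + sum {n} (λ i → sum {d} (λ k → x k * fun φ (ε k i) * fun φ (e i j)))
      ≈⟨ +-congˡ (∑-comm {n} {d} (λ i k → x k * fun φ (ε k i) * fun φ (e i j))) ⟩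
    fun φ (o j) + sum {d} (λ k → sum {n} (λ i → x k * fun φ (ε k i) * fun φ (e i j)))
      ≈⟨ +-congˡ (sum-cong-≋ {d} λ k → trans
           (sum-cong-≋ {n} λ i → trans (*-assoc _ _ _) (*-congˡ (sym (Hom.*-homo φ (ε k i) (e i j)))))
           (sym (*-distribˡ-sum {n} (x k) (λ i → fun φ (ε k i F.* e i j))))) ⟩
    fun φ (o j) + sum {d} (λ k → x k * sum {n} (λ i → fun φ (ε k i F.* e i j)))
      ≈⟨ +-congˡ (sum-cong-≋ {d} λ k → *-congˡ
           (trans (sym (hom-sum φ {n} (λ i → ε k i F.* e i j))) (Hom.cong φ (span k j)))) ⟩
    fun φ (o j) + sum {d} (λ k → x k * fun φ (δ F k j))
      ≈⟨ +-congˡ (sum-δ {d} x j) ⟩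
    fun φ (o j) + (y j - fun φ (o j))
      ≈⟨ trans (+-comm _ _) (trans (+-assoc _ _ _) (trans (+-congˡ (-‿inverseˡ _)) (+-identityʳ _))) ⟩
    y j ∎
    where x = λ k → y k - fun φ (o k)

  ev-expand-coordinates : ∀ {d n} (o : Fin d → ∣ F ∣) (e : Fin n → Fin d → ∣ F ∣) (ε : Fin d → Fin n → ∣ F ∣) →
    IsSpanning F e ε → ∀ y g →
    ev n φ (coordinates o ε y) (Expansion.expand {F = F} o e g) ≈ ev d φ y g
  ev-expand-coordinates o e ε span y =
    Expansion.ev-expand {F = F} o e φ (coordinates o ε y) (affine-coordinates o e ε span y)

-- Substituting the coordinates of the generic point into the expansion gives `g` back.
expand-injective : ∀ {c ℓ} {F : CommutativeRing c ℓ} {d n}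
  (o : Fin d → ∣ F ∣) (e : Fin n → Fin d → ∣ F ∣) (ε : Fin d → Fin n → ∣ F ∣) → IsSpanning F e ε →
  ∀ g → CommutativeRing._≈_ (MP F n) (Expansion.expand {F = F} o e g) (CommutativeRing.0# (MP F n)) →
  CommutativeRing._≈_ (MP F d) g (CommutativeRing.0# (MP F d))
expand-injective {F = F} {d} {n} o e ε span g p =
  trans (sym (ev-identity d g))
    (trans (sym (ev-expand-coordinates (constʰ d) o e ε span (var F d) g))
      (trans (Hom.cong (evʰ n (constʰ d) _) p) (Hom.0-homo (evʰ n (constʰ d) _))))
  where open CommutativeRing (MP F d)

-- Linear systems and polynomials with prescribed vanishing

-- The binomial coefficient C(n + D, n), by Pascal's rule.
simplexSize : ℕ → ℕ → ℕ
simplexSize zero    D       = 1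
simplexSize (suc n) zero    = simplexSize n zero
simplexSize (suc n) (suc D) = simplexSize n (suc D) ℕ.+ simplexSize (suc n) D

exponents : ∀ n → ℕ → List (Vec ℕ n)
exponents zero    D       = [] ∷ []
exponents (suc n) zero    = map (0 ∷_) (exponents n zero)
exponents (suc n) (suc D) = map (0 ∷_) (exponents n (suc D)) List.++ map bump (exponents (suc n) D)

length-exponents : ∀ n D → length (exponents n D) ≡ simplexSize n D
length-exponents zero    D       = ≡.refl
length-exponents (suc n) zero    = ≡.trans (List.length-map _ (exponents n zero)) (length-exponents n zero)
length-exponents (suc n) (suc D) = ≡.trans (List.length-++ (map (0 ∷_) (exponents n (suc D)))) (≡.cong₂ ℕ._+_
  (≡.trans (List.length-map _ (exponents n (suc D))) (length-exponents n (suc D)))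
  (≡.trans (List.length-map _ (exponents (suc n) D)) (length-exponents (suc n) D)))

∈-exponents : ∀ n D (α : Vec ℕ n) → degree α ℕ.≤ D → α ∈ exponents n D
∈-exponents zero    D       []          h = here ≡.refl
∈-exponents (suc n) zero    (zero  ∷ α) h = ∈-map⁺ (0 ∷_) (∈-exponents n zero α h)
∈-exponents (suc n) (suc D) (zero  ∷ α) h = ∈-++⁺ˡ (∈-map⁺ (0 ∷_) (∈-exponents n (suc D) α h))
∈-exponents (suc n) (suc D) (suc a ∷ α) h =
  ∈-++⁺ʳ (map (0 ∷_) (exponents n (suc D))) (∈-map⁺ bump (∈-exponents (suc n) D (a ∷ α) (ℕ.≤-pred h)))

-- Stability replaces decidability: an equation may be proved by refuting its negation, but no case
-- distinction on whether an element is zero is available.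
record StableField c ℓ : Set (lsuc (c ⊔ ℓ)) where
  field ring₀ : CommutativeRing c ℓ
  open CommutativeRing ring₀ hiding (zero) public
  field
    stable  : ∀ {x y} → ¬ ¬ (x ≈ y) → x ≈ y
    1≉0     : ¬ (1# ≈ 0#)
    inverse : ∀ x → ¬ (x ≈ 0#) → ∃[ y ] (x * y ≈ 1#)

module LinearSystems {c ℓ} (𝔽 : StableField c ℓ) where
  open StableField 𝔽 renaming (ring₀ to F)
  open SemiringSum semiring
  open RingProperties ring using (-‿distribʳ-*)
  open SetoidReasoning setoid

  cancel-≉0 : ∀ {x y} → ¬ (x ≈ 0#) → x * y ≈ 0# → y ≈ 0#
  cancel-≉0 {x} {y} x≉0 xy≈0 with inverse x x≉0
  ... | x⁻¹ , xx⁻¹≈1 = begin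
    y             ≈⟨ *-identityˡ y ⟨
    1# * y        ≈⟨ *-congʳ (trans (sym xx⁻¹≈1) (*-comm x x⁻¹)) ⟩
    x⁻¹ * x * y   ≈⟨ *-assoc _ _ _ ⟩
    x⁻¹ * (x * y) ≈⟨ trans (*-congˡ xy≈0) (zeroʳ _) ⟩
    0#            ∎

  -- Gaussian elimination of the unknown `i`. Here `n` is minus the inverse of the pivot; the sign
  -- makes both `eliminate` and the recovered value `s * n` free of subtraction.
  module Elimination {K} (row : Fin (suc K) → Carrier) (i : Fin (suc K)) (n : Carrier)
    (rowᵢn≈-1 : row i * n ≈ - 1#) where

    eliminate : (Fin (suc K) → Carrier) → Fin K → Carrier
    eliminate r j = r (punchIn i j) + (r i * n) * row (punchIn i j)

    module _ (x : Fin K → Carrier) where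
      s : Carrier
      s = sum {K} (λ j → x j * row (punchIn i j))

      extend : Fin (suc K) → Carrier
      extend = insertAt x i (s * n)

      sum-extend : ∀ (r : Fin (suc K) → Carrier) → sum {suc K} (λ j → extend j * r j) ≈
                         (s * n) * r i + sum {K} (λ j → x j * r (punchIn i j))
      sum-extend r = trans (sum-remove {K} {i} (λ j → extend j * r j)) (+-cong
        (*-congʳ (reflexive (insertAt-lookup x i (s * n))))
        (sum-cong-≋ {K} λ j → *-congʳ (reflexive (insertAt-punchIn x i (s * n) j))))

      extend-pivot : sum {suc K} (λ j → extend j * row j) ≈ 0#
      extend-pivot = begin
        sum {suc K} (λ j → extend j * row j) ≈⟨ sum-extend row ⟩
        s * n * row i + s                    ≈⟨ +-congʳ (trans (*-assoc _ _ _) (*-congˡ (trans (*-comm n _) rowᵢn≈-1))) ⟩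
        s * - 1# + s                         ≈⟨ +-congʳ (trans (sym (-‿distribʳ-* s 1#)) (-‿cong (*-identityʳ s))) ⟩
        - s + s                              ≈⟨ -‿inverseˡ s ⟩
        0#                                   ∎

      extend-eliminate : ∀ (r : Fin (suc K) → Carrier) → sum {suc K} (λ j → extend j * r j) ≈ sum {K} (λ j → x j * eliminate r j)
      extend-eliminate r = sym (begin
        sum {K} (λ j → x j * eliminate r j)
          ≈⟨ sum-cong-≋ {K} (λ j → trans (distribˡ (x j) _ _) (+-congˡ (x∙yz≈y∙xz (x j) (r i * n) _))) ⟩
        sum {K} (λ j → x j * r (punchIn i j) + r i * n * (x j * row (punchIn i j)))
          ≈⟨ ∑-distrib-+ {K} (λ j → x j * r (punchIn i j)) _ ⟩
        sum {K} (λ j → x j * r (punchIn i j)) + sum {K} (λ j → r i * n * (x j * row (punchIn i j)))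
          ≈⟨ +-comm _ _ ⟩
        sum {K} (λ j → r i * n * (x j * row (punchIn i j))) + sum {K} (λ j → x j * r (punchIn i j))
          ≈⟨ +-congʳ (sym (*-distribˡ-sum {K} (r i * n) (λ j → x j * row (punchIn i j)))) ⟩
        r i * n * s + sum {K} (λ j → x j * r (punchIn i j))
          ≈⟨ +-congʳ (x∙yz≈zy∙x s n (r i)) ⟨
        s * (n * r i) + sum {K} (λ j → x j * r (punchIn i j))
          ≈⟨ +-congʳ (*-assoc s n (r i)) ⟨
        s * n * r i + sum {K} (λ j → x j * r (punchIn i j))
          ≈⟨ sum-extend r ⟨
        sum {suc K} (λ j → extend j * r j) ∎)
        where open CommutativeSemigroupProperties *-commutativeSemigroup using (x∙yz≈y∙xz; x∙yz≈zy∙x)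

  Solution : ∀ K → List (Fin K → Carrier) → Set (c ⊔ ℓ)
  Solution K rows = Σ (Fin K → Carrier) λ x →
    (∃[ i ] ¬ (x i ≈ 0#)) × All (λ r → sum {K} (λ j → x j * r j) ≈ 0#) rows

  -- No search for a pivot is possible. Instead, supposing that there is no solution, every entry of
  -- the first row is zero, since a nonzero entry would be a pivot and elimination would give a
  -- solution. The zero row can then be dropped with all unknowns kept.
  solve-underdetermined : ∀ K rows → length rows ℕ.< K → ¬ ¬ Solution K rows
  solve-underdetermined (suc K) [] h none = none ((λ _ → 1#) , (zero , 1≉0) , [])
  solve-underdetermined (suc K) (row ∷ rows) h none =
    solve-underdetermined (suc K) rows (ℕ.<-trans (ℕ.n<1+n _) h)
      λ { (x , x≉0 , sol) → none (x , x≉0 ,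
          trans (sum-cong-≋ {suc K} λ i → trans (*-congˡ (row≈0 i)) (zeroʳ (x i)))
            (sum-replicate-zero (suc K)) ∷ sol) }
    where
    row≈0 : ∀ i → row i ≈ 0#
    row≈0 i = stable λ rowᵢ≉0 → pivot (inverse (row i) rowᵢ≉0)
      where
      pivot : ¬ (∃[ y ] (row i * y ≈ 1#))
      pivot (y , rowᵢy≈1) = solve-underdetermined K (map eliminate rows)
        (≡.subst (ℕ._< K) (≡.sym (List.length-map eliminate rows)) (ℕ.≤-pred h))
        λ { (x , (j , xⱼ≉0) , sol) → none (extend x
          , (punchIn i j , λ p → xⱼ≉0 (trans (sym (reflexive (insertAt-punchIn x i _ j))) p))
          , extend-pivot x
            ∷ All.map (λ {r} p → trans (extend-eliminate x r) p) (All.map⁻ sol)) }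
        where open Elimination row i (- y) (trans (sym (-‿distribʳ-* _ y)) (-‿cong rowᵢy≈1))

  open Coefficients F

  -- Pascal's rule as a decomposition: a polynomial of degree at most D + 1 is one without the first
  -- variable plus the first variable times one of degree at most D.
  polynomial : ∀ n D → (Fin (simplexSize n D) → Carrier) → ∣ MP F n ∣
  polynomial zero    D       x = x zero
  polynomial (suc n) zero    x = polynomial n zero x ∷ []
  polynomial (suc n) (suc D) x =
    polynomial n (suc D) (λ i → x (i ↑ˡ simplexSize (suc n) D))
    ∷ polynomial (suc n) D (λ j → x (simplexSize n (suc D) ↑ʳ j))

  polynomial-degree : ∀ n D x → Filtration.V (degreeFiltration F n) D (polynomial n D x)
  polynomial-degree zero    D       x []          ()
  polynomial-degree (suc n) zero    x (zero  ∷ α) h = polynomial-degree n zero x α h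
  polynomial-degree (suc n) zero    x (suc a ∷ α) h = coef-0 n α
  polynomial-degree (suc n) (suc D) x (zero  ∷ α) h = polynomial-degree n (suc D) _ α h
  polynomial-degree (suc n) (suc D) x (suc a ∷ α) h =
    polynomial-degree (suc n) D _ (a ∷ α) (ℕ.≤-pred h)

  polynomial-injective : ∀ n D x → (∀ α → coef n (polynomial n D x) α ≈ 0#) → ∀ i → x i ≈ 0#
  polynomial-injective zero    D       x h zero = h []
  polynomial-injective (suc n) zero    x h i    = polynomial-injective n zero x (h ∘ (0 ∷_)) i
  polynomial-injective (suc n) (suc D) x h i    = ≡.subst (λ i → x i ≈ 0#)
    (join-splitAt (simplexSize n (suc D)) _ i) (split (splitAt (simplexSize n (suc D)) i))
    where
    open import Data.Fin using (splitAt; join)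
    open import Data.Fin.Properties using (join-splitAt)
    split : ∀ s → x (join (simplexSize n (suc D)) (simplexSize (suc n) D) s) ≈ 0#
    split (inj₁ i) = polynomial-injective n (suc D) _ (h ∘ (0 ∷_)) i
    split (inj₂ j) = polynomial-injective (suc n) D _ (λ { (a ∷ α) → h (suc a ∷ α) }) j

  record Linear n (ψ : ∣ MP F n ∣ → Carrier) : Set (c ⊔ ℓ) where
    private module M = CommutativeRing (MP F n)
    field
      cong  : ∀ {P Q} → P M.≈ Q → ψ P ≈ ψ Q
      +-lin : ∀ P Q → ψ (P M.+ Q) ≈ ψ P + ψ Q
      *-lin : ∀ x P → ψ (fun (constʰ n) x M.* P) ≈ x * ψ P

  module _ {n ψ} (lin : Linear (suc n) ψ) where
    private module M = CommutativeRing (MP F n)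
    open Polynomials (MP F n)
    open Linear lin

    linear-const : Linear n (ψ ∘ (_∷ []))
    linear-const = record
      { cong = λ p → cong (Hom.cong constₚ p)
      ; +-lin = λ P Q → trans (cong (Hom.+-homo constₚ P Q)) (+-lin _ _)
      ; *-lin = λ x P → trans (cong (Hom.*-homo constₚ _ P)) (*-lin x _) }

    linear-shift : Linear (suc n) (ψ ∘ (M.0# ∷_))
    linear-shift = record
      { cong = λ p → cong (mk≈ λ { zero → M.refl ; (suc i) → at p i })
      ; +-lin = λ P Q → trans
          (cong (mk≈ λ { zero → M.sym (M.+-identityʳ M.0#) ; (suc i) → M.refl })) (+-lin _ _)
      ; *-lin = λ x P → trans (cong (mk≈ λ
          { zero → M.sym (M.trans (coeff-*-zero (fun (constʰ n) x) [] (M.0# ∷ P)) (M.zeroʳ _))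
          ; (suc i) → M.trans (at (constₚ-* (fun (constʰ n) x) P) i) (M.trans (coeff-scale _ P i)
              (M.sym (M.trans (coeff-*-suc (fun (constʰ n) x) [] (M.0# ∷ P) i) (M.+-identityʳ _)))) }))
          (*-lin x _) }

    linear-∷ : ∀ a f → ψ (a ∷ f) ≈ ψ (a ∷ []) + ψ (M.0# ∷ f)
    linear-∷ a f = trans
      (cong (mk≈ λ { zero → M.sym (M.+-identityʳ a) ; (suc i) → M.refl }))
      (+-lin (a ∷ []) (M.0# ∷ f))

  -- The recursion is that of `polynomial`: `linear-const` restricts the functional to polynomials
  -- without the first variable, `linear-shift` precomposes it with multiplication by that variable.
  linear-row : ∀ n D {ψ} → Linear n ψ →
    Σ (Fin (simplexSize n D) → Carrier) λ r →
    ∀ x → ψ (polynomial n D x) ≈ sum {simplexSize n D} (λ i → x i * r i)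
  linear-row zero D {ψ} lin = (λ _ → ψ 1#) , λ x → begin
    ψ (x zero)          ≈⟨ cong (sym (*-identityʳ _)) ⟩
    ψ (x zero * 1#)     ≈⟨ *-lin (x zero) 1# ⟩
    x zero * ψ 1#       ≈⟨ +-identityʳ _ ⟨
    x zero * ψ 1# + 0#  ∎
    where open Linear lin
  linear-row (suc n) zero    lin = linear-row n zero (linear-const lin)
  linear-row (suc n) (suc D) {ψ} lin
    with linear-row n (suc D) (linear-const lin) | linear-row (suc n) D (linear-shift lin)
  ... | r , hr | r′ , hr′ = r ++ r′ , λ x → begin
    ψ (polynomial (suc n) (suc D) x)
      ≈⟨ linear-∷ lin _ _ ⟩
    ψ (polynomial n (suc D) (λ i → x (i ↑ˡ m′)) ∷ []) + ψ (_ ∷ polynomial (suc n) D (λ j → x (m ↑ʳ j)))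
      ≈⟨ +-cong (hr _) (hr′ _) ⟩
    sum {m} (λ i → x (i ↑ˡ m′) * r i) + sum {m′} (λ j → x (m ↑ʳ j) * r′ j)
      ≈⟨ +-cong (sum-cong-≋ {m} λ i → *-congˡ (reflexive (≡.sym (lookup-++ˡ r r′ i))))
                (sum-cong-≋ {m′} λ j → *-congˡ (reflexive (≡.sym (lookup-++ʳ r r′ j)))) ⟩
    sum {m} (λ i → x (i ↑ˡ m′) * (r ++ r′) (i ↑ˡ m′)) + sum {m′} (λ j → x (m ↑ʳ j) * (r ++ r′) (m ↑ʳ j))
      ≈⟨ sum-++ F m m′ (λ i → x i * (r ++ r′) i) ⟨
    sum {m ℕ.+ m′} (λ i → x i * (r ++ r′) i) ∎
    where
    m = simplexSize n (suc D)
    m′ = simplexSize (suc n) D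

  LinearFunctional : ℕ → Set (c ⊔ ℓ)
  LinearFunctional n = ∃ (Linear n)

  vanishing-polynomial : ∀ n D (ψs : List (LinearFunctional n)) → length ψs ℕ.< simplexSize n D →
    ¬ ¬ (∃[ g ] (¬ (∀ α → coef n g α ≈ 0#)) × Filtration.V (degreeFiltration F n) D g ×
          All (λ ψ → proj₁ ψ g ≈ 0#) ψs)
  vanishing-polynomial n D ψs h none = solve-underdetermined (simplexSize n D) (map row ψs)
    (≡.subst (ℕ._< simplexSize n D) (≡.sym (List.length-map row ψs)) h)
    λ { (x , (i , xᵢ≉0) , sol) → none (polynomial n D x
      , (λ g≈0 → xᵢ≉0 (polynomial-injective n D x g≈0 i))
      , polynomial-degree n D x
      , All.map (λ { {ψ} p → trans (proj₂ (linear-row n D (proj₂ ψ)) x) p }) (All.map⁻ sol)) }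
    where
    row : LinearFunctional n → Fin (simplexSize n D) → Carrier
    row (ψ , lin) = proj₁ (linear-row n D lin)

-- Counting roots with multiplicity

module ℕΣ = SemiringSum ℕ.+-*-semiring

module RootCounting {c ℓ} (𝔽 : StableField c ℓ) where
  open StableField 𝔽 renaming (ring₀ to F)
  open LinearSystems 𝔽 using (cancel-≉0)
  open Polynomials F
  open RingProperties ring using (-‿distribˡ-*)
  open SetoidReasoning setoid

  F[t] : CommutativeRing c ℓ
  F[t] = polyRing

  module T = CommutativeRing F[t]
  open Monomials F[t]

  infix 25 t-_
  t-_ : Carrier → Poly
  t- τ = - τ ∷ 1# ∷ []

  coeff-t--zero : ∀ τ q → coeff (t- τ T.* q) 0 ≈ - τ * coeff q 0
  coeff-t--zero τ q = coeff-*-zero (- τ) (1# ∷ []) q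

  coeff-t--suc : ∀ τ q i → coeff (t- τ T.* q) (suc i) ≈ - τ * coeff q (suc i) + coeff q i
  coeff-t--suc τ q i = trans (coeff-*-suc (- τ) (1# ∷ []) q i) (+-congˡ (at (T.*-identityˡ q) i))

  DegreeBelow : ℕ → Poly → Set ℓ
  DegreeBelow n q = ∀ i → n ℕ.≤ i → coeff q i ≈ 0#

  coeff-beyond-length : ∀ q i → length q ℕ.≤ i → coeff q i ≈ 0#
  coeff-beyond-length []      i       h       = refl
  coeff-beyond-length (a ∷ q) (suc i) (s≤s h) = coeff-beyond-length q i h

  -- Coefficient i of `q` is coefficient i + 1 of the product plus τ times coefficient i + 1 of `q`,
  -- so zeros propagate downwards from the end of the list. For n = 0 the truncated bound says that
  -- `q` is zero.
  degree-t- : ∀ {n} τ q → DegreeBelow n (t- τ T.* q) → DegreeBelow (n ℕ.∸ 1) q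
  degree-t- {n} τ q h i n∸1≤i = descend (length q) i (ℕ.m≤n+m _ i) (ℕ.≤-trans (ℕ.m≤n+m∸n n 1) (s≤s n∸1≤i))
    where
    -- `k` bounds the distance from `i` to the end of the list.
    descend : ∀ k i → length q ℕ.≤ i ℕ.+ k → n ℕ.≤ suc i → coeff q i ≈ 0#
    descend zero    i len n≤ = coeff-beyond-length q i (≡.subst (length q ℕ.≤_) (ℕ.+-identityʳ i) len)
    descend (suc k) i len n≤ = begin
      coeff q i                            ≈⟨ +-identityˡ _ ⟨
      0# + coeff q i                       ≈⟨ +-congʳ (trans (*-congˡ q≈0) (zeroʳ _)) ⟨
      - τ * coeff q (suc i) + coeff q i    ≈⟨ coeff-t--suc τ q i ⟨
      coeff (t- τ T.* q) (suc i)           ≈⟨ h (suc i) n≤ ⟩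
      0#                                   ∎
      where
      q≈0 : coeff q (suc i) ≈ 0#
      q≈0 = descend k (suc i) (≡.subst (length q ℕ.≤_) (ℕ.+-suc i k) len) (ℕ.m≤n⇒m≤1+n n≤)

  degree-pow : ∀ {n} τ b q → DegreeBelow n (pow (t- τ) b T.* q) → DegreeBelow (n ℕ.∸ b) q
  degree-pow {n} τ zero    q h i n≤i = trans (sym (at (T.*-identityˡ q) i)) (h i n≤i)
  degree-pow {n} τ (suc b) q h = ≡.subst (λ m → DegreeBelow m q) (ℕ.∸-+-assoc n 1 b)
    (degree-pow τ b q (degree-t- {n} τ (pow (t- τ) b T.* q)
      λ i n≤i → trans (sym (at (T.*-assoc (t- τ) (pow (t- τ) b) q) i)) (h i n≤i)))

  -- The case n = 0 of `degree-t-`, applied to the difference: t - τ is monic, hence no zero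
  -- divisor.
  t--cancel : ∀ τ p q → t- τ T.* p T.≈ t- τ T.* q → p T.≈ q
  t--cancel τ p q h = x∙y⁻¹≈ε⇒x≈y p q (mk≈ λ i → degree-t- {0} τ (p T.- q)
    (λ j _ → at (T.trans (x[y-z]≈xy-xz (t- τ) p q)
      (T.trans (T.+-congʳ h) (T.-‿inverseʳ (t- τ T.* q)))) j) i z≤n)
    where open RingProperties T.ring using (x∙y⁻¹≈ε⇒x≈y; x[y-z]≈xy-xz)

  evaluation : Carrier → Hom F[t] F
  evaluation τ = evalʰ idʰ τ

  -- Synthetic division: the coefficients of the quotient are the values at τ of the successive
  -- tails, and the remainder is the value of the whole.
  quotient : Carrier → Poly → Poly
  quotient τ []      = []
  quotient τ (a ∷ q) = fun (evaluation τ) q ∷ quotient τ q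

  division : ∀ τ q i →
    coeff q i ≈ coeff (t- τ T.* quotient τ q) i + coeff (fun (evaluation τ) q ∷ []) i
  division τ [] i = sym (trans (+-cong (at (T.zeroʳ (t- τ)) i) (zeros i)) (+-identityˡ 0#))
    where
    zeros : ∀ i → coeff (0# ∷ []) i ≈ 0#
    zeros zero    = refl
    zeros (suc i) = refl
  division τ (a ∷ q) zero = sym (begin
    coeff (t- τ T.* (v ∷ quotient τ q)) 0 + (a + τ * v)
      ≈⟨ +-cong (trans (coeff-t--zero τ (v ∷ quotient τ q)) (sym (-‿distribˡ-* τ v))) (+-comm a _) ⟩
    - (τ * v) + (τ * v + a)
      ≈⟨ +-assoc _ _ _ ⟨
    - (τ * v) + τ * v + a
      ≈⟨ trans (+-congʳ (-‿inverseˡ _)) (+-identityˡ a) ⟩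
    a ∎)
    where v = fun (evaluation τ) q
  division τ (a ∷ q) (suc i) = trans (division τ q i) (sym (trans (+-identityʳ _)
    (trans (coeff-t--suc τ (v ∷ quotient τ q) i) (regroup i))))
    where
    v = fun (evaluation τ) q
    regroup : ∀ i → - τ * coeff (quotient τ q) i + coeff (v ∷ quotient τ q) i
                  ≈ coeff (t- τ T.* quotient τ q) i + coeff (v ∷ []) i
    regroup zero    = +-congʳ (sym (coeff-t--zero τ (quotient τ q)))
    regroup (suc i) = sym (trans (+-identityʳ _) (coeff-t--suc τ (quotient τ q) i))

  factor-theorem : ∀ τ q → fun (evaluation τ) q ≈ 0# → q T.≈ t- τ T.* quotient τ q
  factor-theorem τ q h = mk≈ λ i → trans (division τ q i) (trans (+-congˡ (vanish i)) (+-identityʳ _))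
    where
    vanish : ∀ i → coeff (fun (evaluation τ) q ∷ []) i ≈ 0#
    vanish zero    = h
    vanish (suc i) = refl

  eval-t- : ∀ τ σ → fun (evaluation τ) (t- σ) ≈ τ - σ
  eval-t- τ σ = trans (+-comm _ _)
    (+-congʳ (trans (*-congˡ (trans (+-congˡ (zeroʳ τ)) (+-identityʳ 1#))) (*-identityʳ τ)))

  -- Evaluating at τ gives (τ - σ) q(τ) = 0, so τ is a root of `q`; one factor t - τ is split off
  -- and cancelled on both sides, and the exponent drops.
  divides-t- : ∀ τ σ → ¬ (τ ≈ σ) → ∀ a q → Divides F[t] (t- τ) a (t- σ T.* q) → Divides F[t] (t- τ) a q
  divides-t- τ σ τ≉σ zero    q _       = q , T.sym (T.*-identityˡ q)
  divides-t- τ σ τ≉σ (suc a) q (r , h) =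
    proj₁ rest , T.trans q≈ (T.trans (T.*-congˡ {x = t- τ} (proj₂ rest)) (T.sym (T.*-assoc (t- τ) (pow (t- τ) a) _)))
    where
    open RingProperties ring using (x∙y⁻¹≈ε⇒x≈y)
    open CommutativeSemigroupProperties T.*-commutativeSemigroup using (x∙yz≈y∙xz)
    module E = Hom (evaluation τ)
    h′ : t- σ T.* q T.≈ t- τ T.* (pow (t- τ) a T.* r)
    h′ = T.trans h (T.*-assoc (t- τ) (pow (t- τ) a) r)
    root : fun (evaluation τ) q ≈ 0#
    root = cancel-≉0 (λ p → τ≉σ (x∙y⁻¹≈ε⇒x≈y τ σ p)) (begin
      (τ - σ) * E.fun q                           ≈⟨ *-congʳ (eval-t- τ σ) ⟨
      E.fun (t- σ) * E.fun q                      ≈⟨ E.*-homo (t- σ) q ⟨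
      E.fun (t- σ T.* q)                          ≈⟨ E.cong h′ ⟩
      E.fun (t- τ T.* (pow (t- τ) a T.* r))       ≈⟨ E.*-homo (t- τ) (pow (t- τ) a T.* r) ⟩
      E.fun (t- τ) * E.fun (pow (t- τ) a T.* r)   ≈⟨ *-congʳ (trans (eval-t- τ τ) (-‿inverseʳ τ)) ⟩
      0# * E.fun (pow (t- τ) a T.* r)             ≈⟨ zeroˡ _ ⟩
      0#                                          ∎)
    q≈ : q T.≈ t- τ T.* quotient τ q
    q≈ = factor-theorem τ q root
    rest : Divides F[t] (t- τ) a (quotient τ q)
    rest = divides-t- τ σ τ≉σ a (quotient τ q) (r , t--cancel τ _ _
      (T.trans (x∙yz≈y∙xz (t- τ) (t- σ) (quotient τ q))
        (T.trans (T.*-congˡ {x = t- σ} (T.sym q≈)) h′)))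

  divides-pow : ∀ τ σ → ¬ (τ ≈ σ) → ∀ a b q →
    Divides F[t] (t- τ) a (pow (t- σ) b T.* q) → Divides F[t] (t- τ) a q
  divides-pow τ σ τ≉σ a zero    q (r , h) = r , T.trans (T.sym (T.*-identityˡ q)) h
  divides-pow τ σ τ≉σ a (suc b) q (r , h) = divides-pow τ σ τ≉σ a b q
    (divides-t- τ σ τ≉σ a (pow (t- σ) b T.* q)
      (r , T.trans (T.sym (T.*-assoc (t- σ) (pow (t- σ) b) q)) h))

  -- Split off the first power; by `divides-pow` the other powers still divide the quotient.
  -- Distinctness is asked only between positive exponents, because joints off the line will enter
  -- with exponent zero and a dummy root.
  root-count : ∀ {N} (τ : Fin N → Carrier) (a : Fin N → ℕ) →
    (∀ i j → i ≢ j → 0 ℕ.< a i → 0 ℕ.< a j → ¬ (τ i ≈ τ j)) →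
    ∀ {n} h → DegreeBelow n h → ¬ (h T.≈ T.0#) → (∀ i → Divides F[t] (t- (τ i)) (a i) h) →
    ℕΣ.sum a ℕ.< n
  root-count {zero} τ a distinct {zero}  h deg h≉0 div = ⊥-elim (h≉0 (mk≈ λ i → deg i z≤n))
  root-count {zero} τ a distinct {suc n} h deg h≉0 div = s≤s z≤n
  root-count {suc N} τ a distinct {n} h deg h≉0 div with div zero
  -- Something lies strictly below `n ∸ a zero`, so this difference is positive and the truncated
  -- subtraction is exact.
  ... | q , h≈ = ℕ.<-≤-trans (ℕ.+-monoʳ-< (a zero) rest)
      (ℕ.≤-reflexive (ℕ.m+[n∸m]≡n {a zero} {n} (ℕ.<⇒≤ (ℕ.m∸n≢0⇒n<m {n} (ℕ.m<n⇒n≢0 rest)))))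
    where
    divides-q : ∀ i → 0 ℕ.< a (suc i) ⊎ a (suc i) ℕ.≤ 0 → 0 ℕ.< a zero ⊎ a zero ℕ.≤ 0 →
      Divides F[t] (t- (τ (suc i))) (a (suc i)) q
    divides-q i (inj₂ aᵢ≤0) _ = q , T.trans (T.sym (T.*-identityˡ q))
      (T.*-congʳ (T.reflexive (≡.cong (pow (t- (τ (suc i)))) (≡.sym (ℕ.n≤0⇒n≡0 aᵢ≤0)))))
    divides-q i (inj₁ _) (inj₂ a₀≤0) with div (suc i)
    ... | r , h≈′ = r , T.trans (T.sym (T.trans h≈ (T.trans
      (T.*-congʳ (T.reflexive (≡.cong (pow (t- (τ zero))) (ℕ.n≤0⇒n≡0 a₀≤0)))) (T.*-identityˡ q)))) h≈′
    divides-q i (inj₁ 0<aᵢ) (inj₁ 0<a₀) with div (suc i)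
    ... | r , h≈′ = divides-pow (τ (suc i)) (τ zero) (distinct (suc i) zero (λ ()) 0<aᵢ 0<a₀)
      (a (suc i)) (a zero) q (r , T.trans (T.sym h≈) h≈′)
    rest : ℕΣ.sum (a ∘ suc) ℕ.< n ℕ.∸ a zero
    rest = root-count (τ ∘ suc) (a ∘ suc) (λ i j i≢j → distinct (suc i) (suc j) λ { ≡.refl → i≢j ≡.refl })
      q (degree-pow {n} (τ zero) (a zero) q (λ i n≤i → trans (sym (at h≈ i)) (deg i n≤i)))
      (λ q≈0 → h≉0 (T.trans h≈ (T.trans (T.*-congˡ {x = pow (t- (τ zero)) (a zero)} q≈0) (T.zeroʳ (pow (t- (τ zero)) (a zero))))))
      (λ i → divides-q i (ℕ.<-≤-connex 0 _) (ℕ.<-≤-connex 0 _))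

-- Choice of the multiplicity and the degree

module Counting where
  open import Data.Nat using (_+_; _*_; _^_; _∸_; _≤_; _<_; _!)
  open ℕ.≤-Reasoning
  open +-*-Solver using (solve; _:+_; _:*_; _:=_; con)

  -- The product (D+1)(D+2)...(D+n), which is n! times C(n + D, n); it keeps the estimates free of
  -- division.
  rising : ℕ → ℕ → ℕ
  rising D zero    = 1
  rising D (suc n) = suc D * rising (suc D) n

  rising-+ : ∀ D m n → rising D (m + n) ≡ rising D m * rising (D + m) n
  rising-+ D zero    n = ≡.trans (≡.cong (λ x → rising x n) (≡.sym (ℕ.+-identityʳ D))) (≡.sym (ℕ.*-identityˡ _))
  rising-+ D (suc m) n = ≡.trans (≡.cong (suc D *_) (rising-+ (suc D) m n))
    (≡.trans (≡.sym (ℕ.*-assoc (suc D) (rising (suc D) m) _))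
      (≡.cong (λ x → suc D * rising (suc D) m * rising x n) (≡.sym (ℕ.+-suc D m))))

  rising-last : ∀ D n → rising D (suc n) ≡ rising D n * suc (D + n)
  rising-last D n = ≡.trans (≡.cong (rising D) (≡.sym (ℕ.+-comm n 1)))
    (≡.trans (rising-+ D n 1) (≡.cong (rising D n *_) (ℕ.*-identityʳ _)))

  rising-≤ : ∀ D n → rising D n ≤ (D + n) ^ n
  rising-≤ D n = go D n n ℕ.≤-refl
    where
    go : ∀ D n k → n ≤ k → rising D n ≤ (D + k) ^ n
    go D zero    k       _         = s≤s z≤n
    go D (suc n) (suc k) (s≤s n≤k) = ℕ.*-mono-≤
      (ℕ.≤-trans (s≤s (ℕ.m≤m+n D k)) (ℕ.≤-reflexive (≡.sym (ℕ.+-suc D k))))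
      (ℕ.≤-trans (go (suc D) n k n≤k) (ℕ.≤-reflexive (≡.cong (_^ n) (≡.sym (ℕ.+-suc D k)))))

  ≤-rising : ∀ D n → suc D ^ n ≤ rising D n
  ≤-rising D zero    = s≤s z≤n
  ≤-rising D (suc n) = ℕ.*-monoʳ-≤ (suc D)
    (ℕ.≤-trans (ℕ.^-monoˡ-≤ n (ℕ.n≤1+n (suc D))) (≤-rising (suc D) n))

  simplexSize-! : ∀ n D → simplexSize n D * n ! ≡ rising D n
  simplexSize-! zero    D       = ≡.refl
  simplexSize-! (suc n) zero    = begin-equality
    simplexSize n 0 * (suc n * n !) ≡⟨ solve 3 (λ a b c → a :* (b :* c) := a :* c :* b) ≡.refl (simplexSize n 0) (suc n) (n !) ⟩
    simplexSize n 0 * n ! * suc n   ≡⟨ ≡.cong (_* suc n) (simplexSize-! n zero) ⟩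
    rising 0 n * suc n              ≡⟨ rising-last 0 n ⟨
    rising 0 (suc n)                ∎
  simplexSize-! (suc n) (suc D) = begin-equality
    (simplexSize n (suc D) + simplexSize (suc n) D) * (suc n * n !)
      ≡⟨ solve 4 (λ a b c d → (a :+ b) :* (c :* d) := c :* (a :* d) :+ b :* (c :* d)) ≡.refl
           (simplexSize n (suc D)) (simplexSize (suc n) D) (suc n) (n !) ⟩
    suc n * (simplexSize n (suc D) * n !) + simplexSize (suc n) D * (suc n * n !)
      ≡⟨ ≡.cong₂ (λ a b → suc n * a + b) (simplexSize-! n (suc D)) (simplexSize-! (suc n) D) ⟩
    suc n * rising (suc D) n + suc D * rising (suc D) n
      ≡⟨ solve 3 (λ n D r → (con 1 :+ n) :* r :+ (con 1 :+ D) :* r := r :* (con 1 :+ (con 1 :+ D :+ n))) ≡.refl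
           n D (rising (suc D) n) ⟩
    rising (suc D) n * suc (suc D + n)
      ≡⟨ rising-last (suc D) n ⟨
    rising (suc D) (suc n) ∎

  nCk*k![n∸k]! : ∀ {n k} → k ≤ n → (n C k) * (k ! * (n ∸ k) !) ≡ n !
  nCk*k![n∸k]! {n} {k} k≤n = ≡.trans (≡.cong (_* (k ! * (n ∸ k) !)) (nCk≡n!/k![n-k]! k≤n))
    (m/n*n≡m (k![n∸k]!∣n! k≤n))
    where instance _ = ℕ._!*_!≢0 k (n ∸ k)

  -- The source of the binomial constant. After multiplication by d! = C(d,m) m! k! all simplex
  -- sizes become rising factorials, and (D+1)...(D+k) cancels from both sides. What is left
  -- compares (M+1)...(M+m), at most (M+m)^m, with (D+k+1)...(D+d), at least (D+1)^m.
  dimension-gap : ∀ d m D M X → m ≤ d → X * (d C m) * (M + m) ^ m < suc D ^ m →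
    X * (simplexSize m M * simplexSize (d ∸ m) D) < simplexSize d D
  dimension-gap d m D M X m≤d h = ℕ.*-cancelʳ-< (d !) _ _ (begin-strict
    X * (simplexSize m M * simplexSize k D) * d !
      ≡⟨ ≡.cong (X * (simplexSize m M * simplexSize k D) *_) (nCk*k![n∸k]! m≤d) ⟨
    X * (simplexSize m M * simplexSize k D) * ((d C m) * (m ! * k !))
      ≡⟨ solve 6 (λ x a b c e f → x :* (a :* b) :* (c :* (e :* f)) := x :* c :* (a :* e) :* (b :* f)) ≡.refl
           X (simplexSize m M) (simplexSize k D) (d C m) (m !) (k !) ⟩
    X * (d C m) * (simplexSize m M * m !) * (simplexSize k D * k !)
      ≡⟨ ≡.cong₂ (λ a b → X * (d C m) * a * b) (simplexSize-! m M) (simplexSize-! k D) ⟩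
    X * (d C m) * rising M m * rising D k
      ≤⟨ ℕ.*-monoˡ-≤ (rising D k) (ℕ.*-monoʳ-≤ (X * (d C m)) (rising-≤ M m)) ⟩
    X * (d C m) * (M + m) ^ m * rising D k
      <⟨ ℕ.*-monoˡ-< (rising D k) {{ℕ.>-nonZero (ℕ.<-≤-trans (ℕ.m^n>0 (suc D) k) (≤-rising D k))}} h ⟩
    suc D ^ m * rising D k
      ≤⟨ ℕ.*-monoˡ-≤ (rising D k) (ℕ.≤-trans (ℕ.^-monoˡ-≤ m (s≤s (ℕ.m≤m+n D k))) (≤-rising (D + k) m)) ⟩
    rising (D + k) m * rising D k
      ≡⟨ ℕ.*-comm (rising (D + k) m) (rising D k) ⟩
    rising D k * rising (D + k) m
      ≡⟨ rising-+ D k m ⟨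
    rising D (k + m)
      ≡⟨ ≡.cong (rising D) (ℕ.m∸n+n≡m m≤d) ⟩
    rising D d
      ≡⟨ simplexSize-! d D ⟨
    simplexSize d D * d ! ∎)
    where k = d ∸ m

  -- Bernoulli's inequality (1 - m/Q)^k ≥ 1 - km/Q for Q = M + m, with denominators cleared.
  bernoulli : ∀ M m k → (M + m) ^ k * (M + m) ≤ M ^ k * (M + m) + k * m * (M + m) ^ k
  bernoulli M m zero    = ℕ.≤-reflexive (≡.sym (ℕ.+-identityʳ _))
  bernoulli M m (suc k) = begin
    Q * Q ^ k * Q
      ≡⟨ ℕ.*-assoc Q (Q ^ k) Q ⟩
    Q * (Q ^ k * Q)
      ≤⟨ ℕ.*-monoʳ-≤ Q (bernoulli M m k) ⟩
    Q * (M ^ k * Q + k * m * Q ^ k)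
      ≡⟨ solve 5 (λ M m a b k → (M :+ m) :* (a :* (M :+ m) :+ k :* m :* b)
                := M :* a :* (M :+ m) :+ (m :* ((M :+ m) :* a) :+ k :* m :* ((M :+ m) :* b))) ≡.refl
           M m (M ^ k) (Q ^ k) k ⟩
    M ^ suc k * Q + (m * (Q * M ^ k) + k * m * Q ^ suc k)
      ≤⟨ ℕ.+-monoʳ-≤ (M ^ suc k * Q) (ℕ.+-monoˡ-≤ _
           (ℕ.*-monoʳ-≤ m (ℕ.*-monoʳ-≤ Q (ℕ.^-monoˡ-≤ k (ℕ.m≤m+n M m))))) ⟩
    M ^ suc k * Q + (m * Q ^ suc k + k * m * Q ^ suc k)
      ≡⟨ ≡.cong (M ^ suc k * Q +_) (≡.sym (ℕ.*-distribʳ-+ (Q ^ suc k) m (k * m))) ⟩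
    M ^ suc k * Q + suc k * m * Q ^ suc k ∎
    where Q = M + m

  -- Bernoulli with k = m bounds (X+1) (M/(M+m))^m below by X + 1 - (X+1) m^2 / (M+m). The chosen M
  -- makes the subtracted term less than 1.
  large-multiplicity : ∀ X m → let M = suc (suc X * (m * m)) in X * (M + m) ^ m < suc X * M ^ m
  large-multiplicity X m = ℕ.≰⇒> λ h → ℕ.<⇒≱ small (ℕ.*-cancelʳ-≤ Q (suc X * (m * m)) (Q ^ m) {{ℕ.m^n≢0 Q m}}
    (ℕ.+-cancelˡ-≤ (X * Q ^ m * Q) _ _ (begin
      X * Q ^ m * Q + Q * Q ^ m
        ≡⟨ solve 3 (λ X q Q → X :* q :* Q :+ Q :* q := (con 1 :+ X) :* (q :* Q)) ≡.refl X (Q ^ m) Q ⟩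
      suc X * (Q ^ m * Q)
        ≤⟨ ℕ.*-monoʳ-≤ (suc X) (bernoulli M m m) ⟩
      suc X * (M ^ m * Q + m * m * Q ^ m)
        ≡⟨ solve 5 (λ X a Q p q → X :* (a :* Q :+ p :* q) := X :* a :* Q :+ X :* p :* q) ≡.refl
             (suc X) (M ^ m) Q (m * m) (Q ^ m) ⟩
      suc X * M ^ m * Q + suc X * (m * m) * Q ^ m
        ≤⟨ ℕ.+-monoˡ-≤ _ (ℕ.*-monoˡ-≤ Q h) ⟩
      X * Q ^ m * Q + suc X * (m * m) * Q ^ m ∎)))
    where
    M = suc (suc X * (m * m))
    Q = M + m
    small : suc X * (m * m) < Q
    small = ℕ.m≤m+n M m

  ^-distribʳ-* : ∀ a b n → (a * b) ^ n ≡ a ^ n * b ^ n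
  ^-distribʳ-* a b zero    = ≡.refl
  ^-distribʳ-* a b (suc n) = ≡.trans (≡.cong (a * b *_) (^-distribʳ-* a b n))
    (solve 4 (λ a b c d → a :* b :* (c :* d) := a :* c :* (b :* d)) ≡.refl a b (a ^ n) (b ^ n))

  -- A strict inequality between integers is a gap of at least 1, that is, L^m X + 1 ≤ N^m. A large
  -- multiplicity makes this gap outweigh the difference between M^m and (M+m)^m.
  parameters : ∀ N L X m → 1 ≤ m → 1 ≤ N → L ^ m * X < N ^ m →
    ∃[ M ] ∃[ D ] (L * D < N * suc M × X * (M + m) ^ m < suc D ^ m)
  -- Without lines the first inequality reads 0 < N (M + 1), so `M` may be 0 and `D` only has to be
  -- large.
  parameters (suc N) zero X (suc m) _ _ _ = 0 , X * m′ , s≤s z≤n ,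
    ℕ.m≤m*n (suc (X * m′)) (suc (X * m′) ^ m) {{ℕ.m^n≢0 (suc (X * m′)) m}}
    where m′ = (0 + suc m) ^ suc m
  parameters N@(suc _) L@(suc _) X m _ _ h = M′ , D , small , ℕ.*-cancelˡ-< (L ^ m) _ _ (begin-strict
    L ^ m * (X * (M′ + m) ^ m)
      ≡⟨ ℕ.*-assoc (L ^ m) X _ ⟨
    Y * (M′ + m) ^ m
      ≤⟨ ℕ.*-monoʳ-≤ Y (ℕ.^-monoˡ-≤ m (ℕ.n≤1+n (M′ + m))) ⟩
    Y * (M + m) ^ m
      <⟨ large-multiplicity Y m ⟩
    suc Y * M ^ m
      ≤⟨ ℕ.*-monoˡ-≤ (M ^ m) h ⟩
    N ^ m * M ^ m
      ≡⟨ ^-distribʳ-* N M m ⟨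
    (N * M) ^ m
      ≤⟨ ℕ.^-monoˡ-≤ m large ⟩
    (L * suc D) ^ m
      ≡⟨ ^-distribʳ-* L (suc D) m ⟩
    L ^ m * suc D ^ m ∎)
    where
    Y = L ^ m * X
    M′ = suc Y * (m * m)
    M = suc M′
    -- With the predecessor of N M in the numerator, `D` is the largest integer with L D strictly
    -- below N M.
    t = ℕ.pred (N * M)
    D = t ℕ./ L
    small : L * D < N * M
    small = s≤s (ℕ.≤-trans (ℕ.≤-reflexive (ℕ.*-comm L D)) (m/n*n≤m t L))
    large : N * M ≤ L * suc D
    large = begin
      suc t                    ≡⟨ ≡.cong suc (m≡m%n+[m/n]*n t L) ⟩
      suc (t ℕ.% L + D * L)    ≤⟨ ℕ.+-monoˡ-≤ (D * L) (m%n<n t L) ⟩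
      suc D * L                ≡⟨ ℕ.*-comm (suc D) L ⟩
      L * suc D                ∎

-- Orders and degrees under substitution

module _ {c ℓ p} {R S : CommutativeRing c ℓ} (𝓖 : Filtration p S) k (φ : Hom R S)
  (w : Fin k → ℕ) (r : Fin k → ∣ S ∣) where
  private module R = CommutativeRing R
  open CommutativeRing S hiding (zero)
  open Filtration 𝓖
  open Coefficients R

  -- Substituting elements of order `w i` into terms of weight at least `v` yields order at least
  -- `v`. This is used three times: to pass between joints of a flat, from a joint to a line through
  -- it, and back.
  ev-∈-lower : Antitone 𝓖 → (∀ x → V 0 (fun φ x)) → (∀ i → V (w i) (r i)) →
    ∀ v P → (∀ α → dot w α ℕ.< v → coef k P α R.≈ R.0#) → V v (ev k φ r P)
  ev-∈-lower anti φ∈ r∈ v P low = ev-∈ k φ r (isSub v) P λ α → term α (ℕ.<-≤-connex (dot w α) v)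
    where
    open Monomials S
    term : ∀ α → dot w α ℕ.< v ⊎ v ℕ.≤ dot w α → V v (fun φ (coef k P α) * monomial r α)
    term α (inj₁ lt) = IsSubmonoid.resp (isSub v)
      (sym (trans (*-congʳ (trans (Hom.cong φ (low α lt)) (Hom.0-homo φ))) (zeroˡ _))) (IsSubmonoid.0∈ (isSub v))
    term α (inj₂ ge) = anti ge (*∈ (φ∈ _) (monomial∈ w r∈ α))

  ev-∈-upper : (∀ {u v x} → u ℕ.≤ v → V u x → V v x) → (∀ x → V 0 (fun φ x)) → (∀ i → V (w i) (r i)) →
    ∀ v P → (∀ α → v ℕ.< dot w α → coef k P α R.≈ R.0#) → V v (ev k φ r P)
  ev-∈-upper mono φ∈ r∈ v P high = ev-∈ k φ r (isSub v) P λ α → term α (ℕ.<-≤-connex v (dot w α))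
    where
    open Monomials S
    term : ∀ α → v ℕ.< dot w α ⊎ dot w α ℕ.≤ v → V v (fun φ (coef k P α) * monomial r α)
    term α (inj₁ lt) = IsSubmonoid.resp (isSub v)
      (sym (trans (*-congʳ (trans (Hom.cong φ (high α lt)) (Hom.0-homo φ))) (zeroˡ _))) (IsSubmonoid.0∈ (isSub v))
    term α (inj₂ le) = mono le (*∈ (φ∈ _) (monomial∈ w r∈ α))

module _ {c ℓ} (R : CommutativeRing c ℓ) (k : ℕ) where
  open Filtration (degreeFiltration R k)

  degree-mono : ∀ {u v P} → u ℕ.≤ v → V u P → V v P
  degree-mono u≤v h α v<deg = h α (ℕ.≤-<-trans u≤v v<deg)

  degree-const : ∀ {v} x → V v (fun (constʰ k) x)
  degree-const x = degree-mono z≤n (Coefficients.coef-const-∈ R k (λ α → conditionallyZero R (0 ℕ.< degree α))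
    (λ 0<deg → ⊥-elim (ℕ.n≮0 (≡.subst (0 ℕ.<_) (dot-zero {k} (λ _ → 1)) 0<deg))))

  degree-var : ∀ i → V 1 (var R k i)
  degree-var i = Coefficients.coef-var-∈ R k (λ α → conditionallyZero R (1 ℕ.< degree α)) i
    (λ 1<deg → ⊥-elim (ℕ.<-irrefl ≡.refl (≡.subst (1 ℕ.<_) (dot-unit (λ _ → 1) i) 1<deg)))

-- The least-number principle for an undecidable predicate, by induction on a bound for `f x`.
¬¬-minimal : ∀ {a p} {A : Set a} (f : A → ℕ) (P : A → Set p) → ∃ P →
  ¬ ¬ (∃[ x ] (P x × (∀ y → f y ℕ.< f x → ¬ P y)))
¬¬-minimal f P (x , px) none = go (f x) x ℕ.≤-refl px
  where
  go : ∀ n x → f x ℕ.≤ n → ¬ P x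
  go n x fx≤n px = none (x , px , λ y fy<fx py → below n y (ℕ.≤-trans fy<fx fx≤n) py)
    where
    below : ∀ n y → f y ℕ.< n → ¬ P y
    below (suc n) y (s≤s fy≤n) = go n y fy≤n

-- The double-negation shift, constructively valid because the index set is finite.
¬¬-∀Fin : ∀ {a} n {A : Fin n → Set a} → (∀ i → ¬ ¬ A i) → ¬ ¬ (∀ i → A i)
¬¬-∀Fin zero    h none = none λ ()
¬¬-∀Fin (suc n) h none = h zero λ a → ¬¬-∀Fin n (h ∘ suc) λ as → none λ { zero → a ; (suc i) → as i }

-- Weighted degrees and finite sums

dot-cong : ∀ {k} {w w′ : Fin k → ℕ} → (∀ i → w i ≡ w′ i) → ∀ α → dot w α ≡ dot w′ α
dot-cong w≡ []      = ≡.refl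
dot-cong w≡ (n ∷ α) = ≡.cong₂ (λ a b → n ℕ.* a ℕ.+ b) (w≡ zero) (dot-cong (w≡ ∘ suc) α)

dot-+ : ∀ {k} (w w′ : Fin k → ℕ) α → dot (λ i → w i ℕ.+ w′ i) α ≡ dot w α ℕ.+ dot w′ α
dot-+ w w′ []      = ≡.refl
dot-+ w w′ (n ∷ α) = ≡.trans
  (≡.cong₂ ℕ._+_ (ℕ.*-distribˡ-+ n (w zero) (w′ zero)) (dot-+ (w ∘ suc) (w′ ∘ suc) α))
  (CommutativeSemigroupProperties.interchange ℕ.+-commutativeSemigroup (n ℕ.* w zero) _ _ _)

dot-0 : ∀ {k} (α : Vec ℕ k) → dot (λ _ → 0) α ≡ 0
dot-0 []      = ≡.refl
dot-0 (n ∷ α) = ≡.trans (≡.cong (ℕ._+ dot (λ _ → 0) α) (ℕ.*-zeroʳ n)) (dot-0 α)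

dot-sum : ∀ {k} L (w : Fin L → Fin k → ℕ) α →
  dot (λ i → ℕΣ.sum {L} (λ l → w l i)) α ≡ ℕΣ.sum {L} (λ l → dot (w l) α)
dot-sum zero    w α = dot-0 α
dot-sum (suc L) w α = ≡.trans (dot-+ (w zero) _ α) (≡.cong (dot (w zero) α ℕ.+_) (dot-sum L (w ∘ suc) α))

dot-++ : ∀ {m k} (w : Fin (m ℕ.+ k) → ℕ) (a : Vec ℕ m) (b : Vec ℕ k) →
  dot w (a Vec.++ b) ≡ dot (λ i → w (i ↑ˡ k)) a ℕ.+ dot (λ j → w (m ↑ʳ j)) b
dot-++ w []      b = ≡.refl
dot-++ w (n ∷ a) b = ≡.trans (≡.cong (n ℕ.* w zero ℕ.+_) (dot-++ (w ∘ suc) a b))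
  (≡.sym (ℕ.+-assoc (n ℕ.* w zero) _ _))

length-cartesianProductWith : ∀ {a b c} {A : Set a} {B : Set b} {C : Set c} (f : A → B → C) xs ys →
  length (List.cartesianProductWith f xs ys) ≡ length xs ℕ.* length ys
length-cartesianProductWith f []       ys = ≡.refl
length-cartesianProductWith f (x ∷ xs) ys = ≡.trans (List.length-++ (map (f x) ys))
  (≡.cong₂ ℕ._+_ (List.length-map (f x) ys) (length-cartesianProductWith f xs ys))

sum-indicator : ∀ {L} (l : Fin L) → ℕΣ.sum {L} (λ l′ → if does (l Fin.≟ l′) then 1 else 0) ≡ 1
sum-indicator {suc L} zero    = ≡.cong suc (≡.trans (ℕΣ.sum-replicate-zero L) ≡.refl)
sum-indicator {suc L} (suc l) = sum-indicator l

sum-≤ : ∀ n (x : Fin n → ℕ) D → (∀ i → x i ℕ.≤ D) → ℕΣ.sum x ℕ.≤ n ℕ.* D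
sum-≤ zero    x D h = z≤n
sum-≤ (suc n) x D h = ℕ.+-mono-≤ (h zero) (sum-≤ n (x ∘ suc) D (h ∘ suc))

sum-≥ : ∀ n (x : Fin n → ℕ) D → (∀ i → D ℕ.≤ x i) → n ℕ.* D ℕ.≤ ℕΣ.sum x
sum-≥ zero    x D h = z≤n
sum-≥ (suc n) x D h = ℕ.+-mono-≤ (h zero) (sum-≥ n (x ∘ suc) D (h ∘ suc))

-- Joints

record Configuration {c ℓ} (𝔽 : StableField c ℓ) (d m k N L K : ℕ) : Set (c ⊔ ℓ) where
  open StableField 𝔽
  open SemiringSum semiring
  field
    joint     : Fin N → Fin d → Carrier
    lineBase  : Fin L → Fin d → Carrier
    lineDir   : Fin L → Fin d → Carrier
    flatBase  : Fin K → Fin d → Carrier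
    flatDir   : Fin K → Fin k → Fin d → Carrier
    line      : Fin N → Fin m → Fin L
    flat      : Fin N → Fin K
    time      : Fin N → Fin m → Carrier
    on-line   : ∀ p i j → joint p j ≈ lineBase (line p i) j + time p i * lineDir (line p i) j
    flatCoord : Fin N → Fin k → Carrier
    on-flat   : ∀ p j → joint p j ≈ flatBase (flat p) j + sum {k} (λ i → flatCoord p i * flatDir (flat p) i j)

  frame : Fin N → Fin (m ℕ.+ k) → Fin d → Carrier
  frame p = (lineDir ∘ line p) ++ flatDir (flat p)

  field
    dual      : Fin N → Fin d → Fin (m ℕ.+ k) → Carrier
    spanning  : ∀ p → IsSpanning ring₀ (frame p) (dual p)
    distinct  : ∀ p q → p ≢ q → ¬ (∀ j → joint p j ≈ joint q j)

module JointsBound {c ℓ} (𝔽 : StableField c ℓ) {d m k N L K} (config : Configuration 𝔽 d m k N L K) where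
  open StableField 𝔽 renaming (ring₀ to F)
  open Configuration config
  open LinearSystems 𝔽
  open Coefficients F
  open SemiringSum semiring

  n : ℕ
  n = m ℕ.+ k

  F[x] : CommutativeRing c ℓ
  F[x] = MP F n

  module X = CommutativeRing F[x]
  module XΣ = SemiringSum X.semiring

  x[_] : Fin n → X.Carrier
  x[ i ] = var F n i

  C : Carrier → X.Carrier
  C = fun (constʰ {R = F} n)

  module C = Hom (constʰ {R = F} n)

  expandAt : Fin N → ∣ MP F d ∣ → X.Carrier
  expandAt p = Expansion.expand {F = F} (joint p) (frame p)

  module Weighted (w : Fin n → ℕ) where
    open Filtration (weighted (trivialFiltration F) (trivialFiltration-anti F) n w) public

    lower⇒V : ∀ v P → (∀ α → dot w α ℕ.< v → coef n P α ≈ 0#) → V v P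
    lower⇒V v P h α 0<v∸dot = h α (ℕ.m∸n≢0⇒n<m {v} λ p → ℕ.n≮0 (≡.subst (0 ℕ.<_) p 0<v∸dot))

    V⇒lower : ∀ v P → V v P → ∀ α → dot w α ℕ.< v → coef n P α ≈ 0#
    V⇒lower v P h α dot<v = h α (ℕ.m<n⇒0<n∸m dot<v)

    nonzero⇒≤ : ∀ v P α → V v P → ¬ (coef n P α ≈ 0#) → v ℕ.≤ dot w α
    nonzero⇒≤ v P α h nz = ℕ.≮⇒≥ λ dot<v → nz (V⇒lower v P h α dot<v)

    anti : Antitone (weighted (trivialFiltration F) (trivialFiltration-anti F) n w)
    anti {u} {v} {P} = weighted-anti (trivialFiltration F) (trivialFiltration-anti F) n w {u} {v} {P}

    V0 : ∀ P → V 0 P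
    V0 P = lower⇒V 0 P λ α ()

    var∈ : ∀ i → V (w i) x[ i ]
    var∈ = weighted-var (trivialFiltration F) (trivialFiltration-anti F) n w

    *C∈ : ∀ {v P} x → V v P → V v (P X.* C x)
    *C∈ {v} {P} x h = ≡.subst (λ v → V v (P X.* C x)) (ℕ.+-identityʳ v) (*∈ {v} {0} {P} {C x} h (V0 (C x)))

  -- Lowest degree in these weights is the order of vanishing along the flat.
  normal : Fin n → ℕ
  normal = (λ (_ : Fin m) → 1) ++ (λ (_ : Fin k) → 0)

  module Normal = Weighted normal

  -- Conditions are imposed at one joint of each flat only; this carries them to the other joints of
  -- the flat. The generic point at p is rewritten in coordinates of the frame of q, and the
  -- coordinates along the lines of q are shown to have order at least 1 in those along the lines of
  -- p.
  module SameFlat (p q : Fin N) (same-flat : flat p ≡ flat q) where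
    open X using () renaming (_+_ to _⊕_; _*_ to _⊗_; _≈_ to _≋_)

    W : Fin k → Fin d → Carrier
    W = flatDir (flat q)

    frame-p : ∀ l → frame p (m ↑ʳ l) ≡ W l
    frame-p l = ≡.trans (lookup-++ʳ (lineDir ∘ line p) (flatDir (flat p)) l)
      (≡.cong (λ f → flatDir f l) same-flat)

    frame-q : ∀ l → frame q (m ↑ʳ l) ≡ W l
    frame-q l = lookup-++ʳ (lineDir ∘ line q) (flatDir (flat q)) l

    shift : Fin k → Carrier
    shift l = flatCoord p l - flatCoord q l

    joint-shift : ∀ j → joint p j ≈ joint q j + sum {k} (λ l → shift l * W l j)
    joint-shift j = begin
      joint p j
        ≈⟨ on-flat p j ⟩
      flatBase (flat p) j + sum {k} (λ l → flatCoord p l * flatDir (flat p) l j)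
        ≈⟨ reflexive (≡.cong (λ f → flatBase f j + sum {k} (λ l → flatCoord p l * flatDir f l j)) same-flat) ⟩
      flatBase (flat q) j + sum {k} (λ l → flatCoord p l * W l j)
        ≈⟨ +-congˡ (sum-cong-≋ {k} λ l → trans (*-congʳ (sym (cancel l))) (distribʳ (W l j) _ _)) ⟩
      flatBase (flat q) j + sum {k} (λ l → flatCoord q l * W l j + shift l * W l j)
        ≈⟨ +-congˡ (∑-distrib-+ {k} (λ l → flatCoord q l * W l j) (λ l → shift l * W l j)) ⟩
      flatBase (flat q) j + (sum {k} (λ l → flatCoord q l * W l j) + sum {k} (λ l → shift l * W l j))
        ≈⟨ sym (+-assoc _ _ _) ⟩
      flatBase (flat q) j + sum {k} (λ l → flatCoord q l * W l j) + sum {k} (λ l → shift l * W l j)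
        ≈⟨ +-congʳ (sym (on-flat q j)) ⟩
      joint q j + sum {k} (λ l → shift l * W l j) ∎
      where
      open SetoidReasoning setoid
      cancel : ∀ l → flatCoord q l + shift l ≈ flatCoord p l
      cancel l = trans (+-comm _ _) (trans (+-assoc _ _ _)
        (trans (+-congˡ (-‿inverseˡ (flatCoord q l))) (+-identityʳ _)))

    z : Fin d → X.Carrier
    z j = XΣ.sum {m} (λ i → x[ i ↑ˡ k ] ⊗ C (frame p (i ↑ˡ k) j))

    z∈ : ∀ j → Normal.V 1 (z j)
    z∈ j = sum∈ (weighted (trivialFiltration F) (trivialFiltration-anti F) n normal) 1 {m} _ λ i →
      Normal.*C∈ {1} {x[ i ↑ˡ k ]} _ (≡.subst (λ v → Normal.V v x[ i ↑ˡ k ])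
        (lookup-++ˡ (λ (_ : Fin m) → 1) (λ (_ : Fin k) → 0) i) (Normal.var∈ (i ↑ˡ k)))

    o₀ : Fin d → Carrier
    o₀ _ = 0#

    -- The displacement from q splits into `z`, along the lines of p, and a part inside the flat.
    -- `dual q` gives coordinates `r₀` of `z`, all of order 1. The part inside the flat receives its
    -- evident coordinates `r₁`, with zeros at the lines; `dual q` might give it others, as
    -- coordinates are not shown to be unique.
    r₀ r₁ r : Fin n → X.Carrier
    r₀ = coordinates (constʰ n) o₀ (dual q) z
    r₁ = (λ (_ : Fin m) → X.0#) ++ (λ l → x[ m ↑ʳ l ] ⊕ C (shift l))
    r i = r₀ i ⊕ r₁ i

    r₀∈ : ∀ i → Normal.V 1 (r₀ i)
    r₀∈ i = sum∈ (weighted (trivialFiltration F) (trivialFiltration-anti F) n normal) 1 {d} _ λ j →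
      Normal.*C∈ {1} {z j X.- C 0#} (dual q j i)
        (IsSubmonoid.resp (Normal.isSub 1) {z j} {z j X.- C 0#} (X.sym (minus-C0 (z j))) (z∈ j))
      where
      minus-C0 : ∀ P → P X.- C 0# ≋ P
      minus-C0 P = X.trans (X.+-congˡ (X.trans (X.-‿cong C.0-homo) (RingProperties.-0#≈0# X.ring))) (X.+-identityʳ P)

    r∈ : ∀ i → Normal.V (normal i) (r i)
    r∈ i with splitAt m i
    ... | inj₁ _ = IsSubmonoid.+∈ (Normal.isSub 1) {r₀ i} {X.0#} (r₀∈ i) (IsSubmonoid.0∈ (Normal.isSub 1))
    ... | inj₂ l = Normal.V0 (r₀ i ⊕ (x[ m ↑ʳ l ] ⊕ C (shift l)))

    points-agree : ∀ j → affine {S = F[x]} (constʰ n) (joint q) (frame q) r j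
                       ≋ affine {S = F[x]} (constʰ n) (joint p) (frame p) x[_] j
    points-agree j = begin
      C (joint q j) ⊕ XΣ.sum {n} (λ i → (r₀ i ⊕ r₁ i) ⊗ e i)
        ≈⟨ X.+-congˡ (X.trans (XΣ.sum-cong-≋ {n} λ i → X.distribʳ (e i) (r₀ i) (r₁ i))
             (XΣ.∑-distrib-+ {n} (λ i → r₀ i ⊗ e i) (λ i → r₁ i ⊗ e i))) ⟩
      C (joint q j) ⊕ (XΣ.sum {n} (λ i → r₀ i ⊗ e i) ⊕ XΣ.sum {n} (λ i → r₁ i ⊗ e i))
        ≈⟨ X.+-congˡ (X.+-cong sum-r₀ sum-r₁) ⟩
      C (joint q j) ⊕ (z j ⊕ (y ⊕ C (sum {k} (λ l → shift l * W l j))))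
        ≈⟨ X.+-congˡ (X.sym (X.+-assoc _ _ _)) ⟩
      C (joint q j) ⊕ (z j ⊕ y ⊕ C (sum {k} (λ l → shift l * W l j)))
        ≈⟨ x∙yz≈xz∙y _ _ _ ⟩
      C (joint q j) ⊕ C (sum {k} (λ l → shift l * W l j)) ⊕ (z j ⊕ y)
        ≈⟨ X.+-cong (X.sym (X.trans (C.cong (joint-shift j)) (C.+-homo _ _)))
             (X.+-congˡ (XΣ.sum-cong-≋ {k} λ l → X.*-congˡ (X.reflexive (≡.cong (λ f → C (f j)) (≡.sym (frame-p l)))))) ⟩
      C (joint p j) ⊕ (z j ⊕ XΣ.sum {k} (λ l → x[ m ↑ʳ l ] ⊗ C (frame p (m ↑ʳ l) j)))
        ≈⟨ X.+-congˡ (X.sym (sum-++ F[x] m k (λ i → x[ i ] ⊗ C (frame p i j)))) ⟩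
      C (joint p j) ⊕ XΣ.sum {n} (λ i → x[ i ] ⊗ C (frame p i j)) ∎
      where
      open SetoidReasoning X.setoid
      open CommutativeSemigroupProperties X.+-commutativeSemigroup using (x∙yz≈xz∙y)
      e : Fin n → X.Carrier
      e i = C (frame q i j)
      y : X.Carrier
      y = XΣ.sum {k} (λ l → x[ m ↑ʳ l ] ⊗ C (W l j))
      sum-r₀ : XΣ.sum {n} (λ i → r₀ i ⊗ e i) ≋ z j
      sum-r₀ = X.trans (X.sym (X.trans (X.+-congʳ C.0-homo) (X.+-identityˡ _)))
        (affine-coordinates (constʰ n) o₀ (frame q) (dual q) (spanning q) z j)
      sum-r₁ : XΣ.sum {n} (λ i → r₁ i ⊗ e i) ≋ y ⊕ C (sum {k} (λ l → shift l * W l j))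
      sum-r₁ = begin
        XΣ.sum {n} (λ i → r₁ i ⊗ e i)
          ≈⟨ sum-++ F[x] m k (λ i → r₁ i ⊗ e i) ⟩
        XΣ.sum {m} (λ i → r₁ (i ↑ˡ k) ⊗ e (i ↑ˡ k)) ⊕ XΣ.sum {k} (λ l → r₁ (m ↑ʳ l) ⊗ e (m ↑ʳ l))
          ≈⟨ X.+-cong
               (X.trans (XΣ.sum-cong-≋ {m} λ i → X.trans
                   (X.*-congʳ (X.reflexive (lookup-++ˡ (λ (_ : Fin m) → X.0#) (λ l → x[ m ↑ʳ l ] ⊕ C (shift l)) i)))
                   (X.zeroˡ _))
                 (XΣ.sum-replicate-zero m))
               (XΣ.sum-cong-≋ {k} λ l → X.trans
                 (X.*-cong (X.reflexive (lookup-++ʳ (λ (_ : Fin m) → X.0#) (λ l → x[ m ↑ʳ l ] ⊕ C (shift l)) l))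
                           (X.reflexive (≡.cong (λ f → C (f j)) (frame-q l))))
                 (X.trans (X.distribʳ _ _ _) (X.+-congˡ (X.sym (C.*-homo _ _))))) ⟩
        X.0# ⊕ XΣ.sum {k} (λ l → x[ m ↑ʳ l ] ⊗ C (W l j) ⊕ C (shift l * W l j))
          ≈⟨ X.+-identityˡ _ ⟩
        XΣ.sum {k} (λ l → x[ m ↑ʳ l ] ⊗ C (W l j) ⊕ C (shift l * W l j))
          ≈⟨ XΣ.∑-distrib-+ {k} (λ l → x[ m ↑ʳ l ] ⊗ C (W l j)) (λ l → C (shift l * W l j)) ⟩
        y ⊕ XΣ.sum {k} (λ l → C (shift l * W l j))
          ≈⟨ X.+-congˡ (X.sym (hom-sum (constʰ n) {k} (λ l → shift l * W l j))) ⟩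
        y ⊕ C (sum {k} (λ l → shift l * W l j)) ∎

    vanishing-transfer : ∀ v g → Normal.V v (expandAt q g) → Normal.V v (expandAt p g)
    vanishing-transfer v g h = IsSubmonoid.resp (Normal.isSub v)
      {ev n (constʰ n) r (expandAt q g)} {expandAt p g}
      (Expansion.ev-expand {F = F} (joint q) (frame q) (constʰ n) r points-agree g)
      (ev-∈-lower (weighted (trivialFiltration F) (trivialFiltration-anti F) n normal) n (constʰ n) normal r
        (λ {u} {v} {P} → Normal.anti {u} {v} {P}) (λ x → Normal.V0 (C x)) r∈ v (expandAt q g)
        (Normal.V⇒lower v (expandAt q g) h))

  -- Linear conditions for vanishing along the flats

  coefficient-linear : ∀ p γ → Linear d (λ g → coef n (expandAt p g) γ)
  coefficient-linear p γ = record
    { cong = λ g≈h → coef-cong n (E.cong g≈h) γ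
    ; +-lin = λ g h → trans (coef-cong n (E.+-homo g h) γ) (coef-+ n (expandAt p g) (expandAt p h) γ)
    ; *-lin = λ x g → trans
        (coef-cong n (X.trans (E.*-homo _ g) (X.*-congʳ (ev-const d (constʰ n) _ x))) γ)
        (coef-scale n x (expandAt p g) γ) }
    where module E = Hom (Expansion.expansion {F = F} (joint p) (frame p))

  expand-degree : ∀ p D g → Filtration.V (degreeFiltration F d) D g →
    Filtration.V (degreeFiltration F n) D (expandAt p g)
  expand-degree p D g = ev-∈-upper (degreeFiltration F n) d (constʰ n) (λ _ → 1) _
    (λ {u} {v} {P} → degree-mono F n {u} {v} {P}) (degree-const F n {0})
    (λ j → +∈ {C (joint p j)} (degree-const F n {1} (joint p j))
      (sum∈ (degreeFiltration F n) 1 {n} _ λ i →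
        *∈ {1} {0} {x[ i ]} {C (frame p i j)} (degree-var F n i) (degree-const F n {0} (frame p i j))))
    D g
    where
    open Filtration (degreeFiltration F n)
    open IsSubmonoid (isSub 1)

  dot-normal : ∀ (a : Vec ℕ m) (b : Vec ℕ k) → dot normal (a Vec.++ b) ≡ degree a
  dot-normal a b = ≡.trans (dot-++ normal a b) (≡.trans (≡.cong₂ ℕ._+_
    (dot-cong (lookup-++ˡ (λ (_ : Fin m) → 1) (λ (_ : Fin k) → 0)) a)
    (≡.trans (dot-cong (lookup-++ʳ (λ (_ : Fin m) → 1) (λ (_ : Fin k) → 0)) b) (dot-0 b)))
    (ℕ.+-identityʳ _))

  -- Vanishing to order M + 1 concerns all terms of degree at most M in the line coordinates. Those
  -- of degree above D in the flat coordinates vanish by `expand-degree`, which leaves a product of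
  -- two simplices of conditions for each flat.
  module Conditions (rep : Fin K → Fin N) (M D : ℕ) where
    low-exponents : List (Vec ℕ n)
    low-exponents = List.cartesianProductWith Vec._++_ (exponents m M) (exponents k D)

    condition : Fin K → Vec ℕ n → LinearFunctional d
    condition f γ = _ , coefficient-linear (rep f) γ

    conditions : List (LinearFunctional d)
    conditions = List.cartesianProductWith condition (List.allFin K) low-exponents

    length-conditions : length conditions ≡ K ℕ.* (simplexSize m M ℕ.* simplexSize k D)
    length-conditions = ≡.trans (length-cartesianProductWith condition (List.allFin K) low-exponents)
      (≡.cong₂ ℕ._*_ (List.length-tabulate {n = K} (λ i → i))
        (≡.trans (length-cartesianProductWith Vec._++_ (exponents m M) (exponents k D))
          (≡.cong₂ ℕ._*_ (length-exponents m M) (length-exponents k D))))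

    conditions-suffice : ∀ g → Filtration.V (degreeFiltration F d) D g →
      All (λ ψ → proj₁ ψ g ≈ 0#) conditions → ∀ f → Normal.V (suc M) (expandAt (rep f) g)
    conditions-suffice g deg vanish f = Normal.lower⇒V (suc M) (expandAt (rep f) g) λ α → low α
      where
      low : ∀ α → dot normal α ℕ.< suc M → coef n (expandAt (rep f) g) α ≈ 0#
      low α h with Vec.splitAt m α
      ... | a , b , ≡.refl with ℕ.<-≤-connex D (degree b)
      ...   | inj₁ D<b = expand-degree (rep f) D g deg (a Vec.++ b)
                (ℕ.<-≤-trans D<b (ℕ.≤-trans (ℕ.m≤n+m _ (degree a)) (ℕ.≤-reflexive (≡.sym (dot-++ (λ _ → 1) a b)))))
      ...   | inj₂ b≤D = All.lookup vanish (∈-cartesianProductWith⁺ condition (∈-allFin f)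
                (∈-cartesianProductWith⁺ Vec._++_
                  (∈-exponents m M a (ℕ.≤-pred (≡.subst (ℕ._< suc M) (dot-normal a b) h)))
                  (∈-exponents k D b b≤D)))

  -- A polynomial along one line

  module Along (l : Fin L) where
    open RootCounting 𝔽 using (F[t]; t-_; DegreeBelow; root-count; module T)

    S : CommutativeRing c ℓ
    S = MP F[t] d

    module S = CommutativeRing S

    κ : Carrier → ∣ F[t] ∣
    κ = fun (constₚ {R = F})

    φ : Hom F S
    φ = constʰ d ∘ʰ constₚ

    point : Carrier → Carrier → ∣ F[t] ∣
    point b u = b ∷ u ∷ []

    -- The generic point b + t u + z near the line; letting z range over all of F^d, rather than over a
    -- complement of u, makes the order of vanishing along the line independent of any frame.
    y : Fin d → S.Carrier
    y j = fun (constʰ d) (point (lineBase l j) (lineDir l j)) S.+ var F[t] d j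

    restrict : ∣ MP F d ∣ → S.Carrier
    restrict = ev d φ y

    restrict-degree : ∀ D g → Filtration.V (degreeFiltration F d) D g →
      ∀ β → DegreeBelow (suc D) (Coefficients.coef F[t] d (restrict g) β)
    restrict-degree D g deg β i D<i = ev-∈-upper 𝓓 d φ (λ _ → 1) y
      (λ {u} {v} {P} u≤v h β → degree-mono F 1 {u} {v} u≤v (h β))
      (λ x → Coefficients.coef-const-∈ F[t] d (λ _ → 𝓣.isSub 0) (degree-const F 1 {0} x))
      (λ j → IsSubmonoid.+∈ (Filtration.isSub 𝓓 1)
        (Coefficients.coef-const-∈ F[t] d (λ _ → 𝓣.isSub 1) linear)
        (Coefficients.coef-var-∈ F[t] d (λ _ → 𝓣.isSub 1) j (degree-const F 1 {1} 1#)))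
      D g deg β (i ∷ [])
      (≡.subst (D ℕ.<_) (≡.sym (≡.trans (ℕ.+-identityʳ _) (ℕ.*-identityʳ i))) D<i)
      where
      module 𝓣 = Filtration (degreeFiltration F 1)
      𝓓 : Filtration ℓ S
      𝓓 = coefficientwise (degreeFiltration F 1) d
      linear : ∀ {b u} → 𝓣.V 1 (point b u)
      linear (zero        ∷ []) ()
      linear (suc zero    ∷ []) (s≤s ())
      linear (suc (suc i) ∷ []) _ = refl

    on : Fin N → Fin n → Bool
    on p = (λ i → does (line p i Fin.≟ l)) ++ (λ _ → false)

    -- The tangential weight of an exponent is its share in the coordinates belonging to `l`;
    -- everything else, the flat coordinates included, is transverse.
    transverse tangential : Fin N → Fin n → ℕ
    transverse p i = if on p i then 0 else 1
    tangential p i = if on p i then 1 else 0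

    transverse+tangential : ∀ p α → dot (transverse p) α ℕ.+ dot (tangential p) α ≡ degree α
    transverse+tangential p α = ≡.trans (≡.sym (dot-+ (transverse p) (tangential p) α)) (dot-cong one α)
      where
      one : ∀ i → transverse p i ℕ.+ tangential p i ≡ 1
      one i with on p i
      ... | true  = ≡.refl
      ... | false = ≡.refl

    module OnLine (p : Fin N) (i₀ : Fin m) (on-l : line p i₀ ≡ l) where
      τ : Carrier
      τ = time p i₀

      joint-on-l : ∀ j → joint p j ≈ lineBase l j + τ * lineDir l j
      joint-on-l j = trans (on-line p i₀ j)
        (reflexive (≡.cong (λ l → lineBase l j + τ * lineDir l j) on-l))

      private
        module Adic = Filtration (weighted (adicFiltration F[t] (t- τ)) (adicFiltration-anti F[t] (t- τ)) d (λ _ → 1))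

        φ∈ : ∀ x → Adic.V 0 (fun φ x)
        φ∈ x = weighted-const (adicFiltration F[t] (t- τ)) (adicFiltration-anti F[t] (t- τ)) d (λ _ → 1) {0}
          (κ x , T.sym (T.*-identityˡ _))

        displacement : ∀ j → y j S.- fun φ (joint p j) S.≈
          fun (constʰ d) (t- τ T.* κ (lineDir l j)) S.+ var F[t] d j
        displacement j = begin
          cst (point b u) S.+ v S.- cst o
            ≈⟨ S.+-congʳ (S.+-congʳ (S.trans (Hom.cong (constʰ d) split) (Hom.+-homo (constʰ d) o q))) ⟩
          cst o S.+ cst q S.+ v S.- cst o
            ≈⟨ S.+-congʳ (S.+-assoc _ _ _) ⟩
          cst o S.+ (cst q S.+ v) S.- cst o
            ≈⟨ xyx⁻¹≈y (cst o) (cst q S.+ v) ⟩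
          cst q S.+ v ∎
          where
          open SetoidReasoning S.setoid
          open AbelianGroupProperties S.+-abelianGroup using (xyx⁻¹≈y)
          b = lineBase l j
          u = lineDir l j
          v = var F[t] d j
          cst : ∣ F[t] ∣ → S.Carrier
          cst = fun (constʰ d)
          o = κ (joint p j)
          q = t- τ T.* κ u
          split : point b u T.≈ o T.+ q
          split = Polynomials.mk≈ λ
            { zero → sym (trans (Polynomials.coeff-+ F o q 0)
                (trans (+-cong (joint-on-l j) (Polynomials.coeff-*-zero F (- τ) (1# ∷ []) (u ∷ [])))
                  (trans (+-congˡ (sym (-‿distribˡ-* τ u)))
                    (trans (+-assoc _ _ _) (trans (+-congˡ (-‿inverseʳ _)) (+-identityʳ b))))))
            ; (suc zero) → sym (trans (Polynomials.coeff-+ F o q 1) (trans (+-identityˡ _)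
                (trans (Polynomials.coeff-*-suc F (- τ) (1# ∷ []) (u ∷ []) 0)
                  (trans (+-cong (zeroʳ _) (Polynomials.coeff-*-zero F 1# [] (u ∷ [])))
                    (trans (+-identityˡ _) (*-identityˡ u))))))
            ; (suc (suc i)) → sym (trans (Polynomials.coeff-+ F o q (suc (suc i))) (trans (+-identityˡ _)
                (trans (Polynomials.coeff-*-suc F (- τ) (1# ∷ []) (u ∷ []) (suc i))
                  (trans (+-cong (zeroʳ _) (trans (Polynomials.coeff-*-suc F 1# [] (u ∷ []) i)
                    (trans (+-cong (zeroʳ _) refl) (+-identityˡ 0#)))) (+-identityˡ 0#))))) }
            where open RingProperties ring using (-‿distribˡ-*)

        coordinates∈ : ∀ i → Adic.V 1 (coordinates φ (joint p) (dual p) y i)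
        coordinates∈ i = sum∈ (weighted (adicFiltration F[t] (t- τ)) (adicFiltration-anti F[t] (t- τ)) d (λ _ → 1)) 1 {d} _
          λ j → Adic.*∈ {1} {0} (IsSubmonoid.resp (Adic.isSub 1) (S.sym (displacement j))
            (IsSubmonoid.+∈ (Adic.isSub 1)
              (weighted-const (adicFiltration F[t] (t- τ)) (adicFiltration-anti F[t] (t- τ)) d (λ _ → 1) {1}
                (κ (lineDir l j) , T.*-congʳ {κ (lineDir l j)} (T.sym (T.*-identityʳ (t- τ)))))
              (weighted-var (adicFiltration F[t] (t- τ)) (adicFiltration-anti F[t] (t- τ)) d (λ _ → 1) j)))
            (φ∈ (dual p j i))

      -- Relative to the joint the generic point is displaced by (t - τ) u + z, which has order 1
      -- when t - τ and the variables z each count 1. Hence order `v` at the joint passes to the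
      -- restriction, and a coefficient of degree |β| in z must supply the remaining v - |β| factors
      -- t - τ.
      restrict-divisible : ∀ v g → (∀ α → degree α ℕ.< v → coef n (expandAt p g) α ≈ 0#) →
        ∀ β → Divides F[t] (t- τ) (v ℕ.∸ degree β) (Coefficients.coef F[t] d (restrict g) β)
      restrict-divisible v g low = IsSubmonoid.resp (Adic.isSub v)
        (ev-expand-coordinates φ (joint p) (frame p) (dual p) (spanning p) y g)
        (ev-∈-lower (weighted (adicFiltration F[t] (t- τ)) (adicFiltration-anti F[t] (t- τ)) d (λ _ → 1)) n φ
          (λ _ → 1) (coordinates φ (joint p) (dual p) y)
          (weighted-anti (adicFiltration F[t] (t- τ)) (adicFiltration-anti F[t] (t- τ)) d (λ _ → 1))
          φ∈ coordinates∈ v (expandAt p g) low)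

      private
        module Across = Weighted (transverse p)

        frame-on-l : ∀ i → on p i ≡ true → frame p i ≡ lineDir l
        frame-on-l i h with splitAt m i
        ... | inj₁ i′ with line p i′ Fin.≟ l
        ...   | yes eq = ≡.cong lineDir eq
        frame-on-l i () | inj₂ _

        along across : Fin n → X.Carrier
        along  i = if on p i then x[ i ] else X.0#
        across i = if on p i then X.0# else x[ i ]

        across∈ : ∀ i → Across.V 1 (across i)
        across∈ i = go (on p i) ≡.refl
          where
          go : ∀ b → on p i ≡ b → Across.V 1 (if b then X.0# else x[ i ])
          go true  _ = IsSubmonoid.0∈ (Across.isSub 1)
          go false h = ≡.subst (λ b → Across.V (if b then 0 else 1) x[ i ]) h (Across.var∈ i)

        decompose : ∀ i j → along i X.* C (lineDir l j) X.+ across i X.* C (frame p i j)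
                            X.≈ x[ i ] X.* C (frame p i j)
        decompose i j = go (on p i) ≡.refl
          where
          go : ∀ b → on p i ≡ b → (if b then x[ i ] else X.0#) X.* C (lineDir l j)
                 X.+ (if b then X.0# else x[ i ]) X.* C (frame p i j) X.≈ x[ i ] X.* C (frame p i j)
          go true  h = X.trans (X.+-congˡ (X.zeroˡ _)) (X.trans (X.+-identityʳ _)
            (X.*-congˡ (X.reflexive (≡.cong (λ f → C (f j)) (≡.sym (frame-on-l i h))))))
          go false h = X.trans (X.+-congʳ (X.zeroˡ _)) (X.+-identityˡ _)

        t↦ : X.Carrier
        t↦ = C τ X.+ XΣ.sum {n} along

        z : Fin d → X.Carrier
        z j = XΣ.sum {n} (λ i → across i X.* C (frame p i j))

        ψ : Hom F[t] F[x]
        ψ = evalʰ (constʰ n) t↦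

        -- The substitution that undoes `restrict`: t becomes τ plus the coordinates along `l`, and
        -- z becomes the combination of the other frame vectors, so b + t u + z becomes the generic
        -- point at the joint.
        point↦ : ∀ j → ev d ψ z (y j) X.≈ affine {S = F[x]} (constʰ n) (joint p) (frame p) x[_] j
        point↦ j = begin
          ev d ψ z (y j)
            ≈⟨ Hom.+-homo (evʰ d ψ z) _ _ ⟩
          ev d ψ z (fun (constʰ d) (point b u)) X.+ ev d ψ z (var F[t] d j)
            ≈⟨ X.+-cong (ev-const d ψ z (point b u)) (ev-var d ψ z j) ⟩
          C b X.+ t↦ X.* (C u X.+ t↦ X.* X.0#) X.+ z j
            ≈⟨ X.+-congʳ (X.+-congˡ (X.trans
                 (X.*-congˡ (X.trans (X.+-congˡ (X.zeroʳ t↦)) (X.+-identityʳ (C u))))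
                 (X.trans (X.distribʳ (C u) (C τ) _)
                   (X.+-cong (X.sym (C.*-homo τ u)) (XΣ.*-distribʳ-sum {n} (C u) along))))) ⟩
          C b X.+ (C (τ * u) X.+ A) X.+ z j
            ≈⟨ X.trans (X.+-congʳ (X.sym (X.+-assoc (C b) _ A))) (X.+-assoc _ A (z j)) ⟩
          C b X.+ C (τ * u) X.+ (A X.+ z j)
            ≈⟨ X.+-cong (X.sym (X.trans (C.cong (joint-on-l j)) (C.+-homo _ _)))
                 (X.sym (X.trans (XΣ.sum-cong-≋ {n} λ i → X.sym (decompose i j))
                   (XΣ.∑-distrib-+ {n} (λ i → along i X.* C u) (λ i → across i X.* C (frame p i j))))) ⟩
          C (joint p j) X.+ XΣ.sum {n} (λ i → x[ i ] X.* C (frame p i j)) ∎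
          where
          open SetoidReasoning X.setoid
          b = lineBase l j
          u = lineDir l j
          A = XΣ.sum {n} (λ i → along i X.* C u)

        expand-restrict : ∀ g → ev d ψ z (restrict g) X.≈ expandAt p g
        expand-restrict g = X.trans (ev-natural d (evʰ d ψ z) φ y g)
          (ev-cong d (evʰ d ψ z ∘ʰ φ) (constʰ n)
            (λ x → X.trans (ev-const d ψ z (κ x)) (X.trans (X.+-congˡ (X.zeroʳ t↦)) (X.+-identityʳ (C x))))
            point↦ g)

      -- Each z is replaced by an expression of transverse weight 1, so terms of degree at least `v`
      -- in z produce only terms of transverse weight at least `v`. This bounds the order along the
      -- line by the transverse weight of any nonzero term at the joint.
      expand-lower : ∀ v g → (∀ β → degree β ℕ.< v → Coefficients.coef F[t] d (restrict g) β T.≈ T.0#) →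
        Across.V v (expandAt p g)
      expand-lower v g low = IsSubmonoid.resp (Across.isSub v)
        {ev d ψ z (restrict g)} {expandAt p g} (expand-restrict g)
        (ev-∈-lower (weighted (trivialFiltration F) (trivialFiltration-anti F) n (transverse p)) d ψ (λ _ → 1) z
          (λ {u} {v} {P} → Across.anti {u} {v} {P}) (λ h → Across.V0 (fun ψ h))
          (λ j → sum∈ (weighted (trivialFiltration F) (trivialFiltration-anti F) n (transverse p)) 1 {n} _
            λ i → Across.*C∈ {1} {across i} (frame p i j) (across∈ i))
          v (restrict g) low)

    module _ (g : ∣ MP F d ∣) (D : ℕ) (g-degree : Filtration.V (degreeFiltration F d) D g)
      (α : Fin N → Vec ℕ n)
      (α-nonzero : ∀ p → ¬ (coef n (expandAt p g) (α p) ≈ 0#))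
      (α-minimal : ∀ p β → degree β ℕ.< degree (α p) → coef n (expandAt p g) β ≈ 0#) where
      private
        a : Fin N → ℕ
        a p = dot (tangential p) (α p)

        on? : ∀ p → Dec (∃[ i ] line p i ≡ l)
        on? p = Fin.any? (λ i → line p i Fin.≟ l)

        off⇒0 : ∀ p → ¬ (∃[ i ] line p i ≡ l) → a p ≡ 0
        off⇒0 p off = ≡.trans (dot-cong zeros (α p)) (dot-0 (α p))
          where
          zeros : ∀ i → tangential p i ≡ 0
          zeros i with splitAt m i
          ... | inj₂ _ = ≡.refl
          ... | inj₁ i′ with line p i′ Fin.≟ l
          ...   | yes eq = ⊥-elim (off (i′ , eq))
          ...   | no _   = ≡.refl

        coefᵗ : Vec ℕ d → ∣ F[t] ∣
        coefᵗ = Coefficients.coef F[t] d (restrict g)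

        -- That `g` has a nonzero coefficient along the line is read off at a joint on it: if all
        -- coefficients were zero, `expand-lower` would apply with every `v`, against the nonzero
        -- term `α p`.
        ¬¬-leading : ∀ p i → line p i ≡ l →
          ¬ ¬ (∃[ β ] (¬ (coefᵗ β T.≈ T.0#) × (∀ γ → degree γ ℕ.< degree β → ¬ ¬ (coefᵗ γ T.≈ T.0#))))
        ¬¬-leading p i on-l none = ℕ.<-irrefl ≡.refl
          (Weighted.nonzero⇒≤ (transverse p) v (expandAt p g) (α p)
            (OnLine.expand-lower p i on-l v g λ β _ → Polynomials.mk≈ λ e → stable λ nz →
              ¬¬-minimal degree (λ β → ¬ (coefᵗ β T.≈ T.0#)) (β , λ h → nz (Polynomials.at h e)) none)
            (α-nonzero p))
          -- One more than the transverse weight of `α p` is already contradictory.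
          where v = suc (dot (transverse p) (α p))

        τ : ∀ p → Dec (∃[ i ] line p i ≡ l) → Carrier
        τ p (yes (i , _)) = time p i
        -- A dummy value: the exponent of a joint off the line is zero.
        τ p (no _)        = 0#

        distinct-τ : ∀ p q (p? : Dec (∃[ i ] line p i ≡ l)) (q? : Dec (∃[ i ] line q i ≡ l)) →
          p ≢ q → 0 ℕ.< a p → 0 ℕ.< a q → ¬ (τ p p? ≈ τ q q?)
        distinct-τ p q (no off) q? _ 0<a _ _ = ℕ.n≮0 (≡.subst (0 ℕ.<_) (off⇒0 p off) 0<a)
        distinct-τ p q (yes _) (no off) _ _ 0<a _ = ℕ.n≮0 (≡.subst (0 ℕ.<_) (off⇒0 q off) 0<a)
        distinct-τ p q (yes (i , on-l)) (yes (i′ , on-l′)) p≢q _ _ τ≈τ = distinct p q p≢q λ j →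
          trans (OnLine.joint-on-l p i on-l j)
            (trans (+-congˡ (*-congʳ τ≈τ)) (sym (OnLine.joint-on-l q i′ on-l′ j)))

        module _ (β : Vec ℕ d) (low : ∀ γ → degree γ ℕ.< degree β → coefᵗ γ T.≈ T.0#) where
          divisible : ∀ p (p? : Dec (∃[ i ] line p i ≡ l)) → Divides F[t] (t- (τ p p?)) (a p) (coefᵗ β)
          divisible p (no off) = ≡.subst (λ e → Divides F[t] (t- 0#) e (coefᵗ β)) (≡.sym (off⇒0 p off))
            (coefᵗ β , T.sym (T.*-identityˡ (coefᵗ β)))
          divisible p (yes (i , on-l)) = adicFiltration-anti F[t] (t- (time p i)) le
            (OnLine.restrict-divisible p i on-l (degree (α p)) g (α-minimal p) β)
            where
            le : a p ℕ.≤ degree (α p) ℕ.∸ degree β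
            -- The order `degree β` along the line is at most the transverse weight of `α p`, and
            -- the tangential weight is the rest of its degree.
            le = ℕ.m+n≤o⇒m≤o∸n (a p) (ℕ.≤-trans
              (ℕ.+-monoʳ-≤ (a p) (Weighted.nonzero⇒≤ (transverse p) (degree β) (expandAt p g) (α p)
                (OnLine.expand-lower p i on-l (degree β) g low) (α-nonzero p)))
              (ℕ.≤-reflexive (≡.trans (ℕ.+-comm (a p) _) (transverse+tangential p (α p)))))

      -- A joint on the line makes `¬¬-leading` available, and then the roots of one nonzero
      -- coefficient of degree at most `D` are counted. If no joint lies on the line, all summands
      -- are zero.
      line-bound : ℕΣ.sum {N} a ℕ.≤ D
      line-bound with Fin.any? on?
      ... | no none = ℕ.≤-trans (ℕ.≤-reflexive (≡.trans
              (ℕΣ.sum-cong-≗ {N} λ p → off⇒0 p λ on-l → none (p , on-l)) (ℕΣ.sum-replicate-zero N))) z≤n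
      ... | yes (p₀ , i₀ , on-l) = decidable-stable (ℕΣ.sum {N} a ℕ.≤? D) λ ≰D →
        ¬¬-leading p₀ i₀ on-l λ { (β , nz , low) → ≰D (ℕ.≤-pred
          (root-count {N} (λ p → τ p (on? p)) a (λ p q → distinct-τ p q (on? p) (on? q))
            (coefᵗ β) (restrict-degree D g g-degree β) nz
            (λ p → divisible β (λ γ lt → Polynomials.mk≈ λ e → stable λ c≉0 →
              low γ lt λ h → c≉0 (Polynomials.at h e)) p (on? p)))) }

  -- Double counting over joints and lines

  tangential-sum : ∀ p i → ℕΣ.sum {L} (λ l → Along.tangential l p i) ≡ normal i
  tangential-sum p i with splitAt m i
  ... | inj₁ i′ = sum-indicator (line p i′)
  ... | inj₂ _  = ℕΣ.sum-replicate-zero L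

  -- The polynomial and a lowest term at every joint are obtained under double negation; the
  -- finitely many joints allow all the terms to be chosen at once, and decidability of the
  -- inequality removes the negations.
  multiplicity-bound : ∀ M D (rep : Fin K → Fin N) → (∀ p → flat (rep (flat p)) ≡ flat p) →
    K ℕ.* (simplexSize m M ℕ.* simplexSize k D) ℕ.< simplexSize d D → N ℕ.* suc M ℕ.≤ L ℕ.* D
  multiplicity-bound M D rep rep-flat gap = decidable-stable (N ℕ.* suc M ℕ.≤? L ℕ.* D) λ ≰ →
    vanishing-polynomial d D conditions (≡.subst (ℕ._< simplexSize d D) (≡.sym length-conditions) gap)
      λ { (g , g≉0 , g-degree , vanish) → ¬¬-∀Fin N (leading g g≉0) λ lead →
        ≰ (double-count g g-degree vanish (proj₁ ∘ lead) (proj₁ ∘ proj₂ ∘ lead) (λ p → proj₂ (proj₂ (lead p)))) }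
    where
    open Conditions rep M D

    Leading : ∣ MP F d ∣ → Fin N → Vec ℕ n → Set ℓ
    Leading g p α = ¬ (coef n (expandAt p g) α ≈ 0#)
                  × (∀ β → degree β ℕ.< degree α → coef n (expandAt p g) β ≈ 0#)

    leading : ∀ g → ¬ (∀ α → coef d g α ≈ 0#) → ∀ p → ¬ ¬ (∃ (Leading g p))
    leading g g≉0 p none = g≉0 λ α → trans (coef-cong d g≈0 α) (coef-0 d α)
      where
      g≈0 : CommutativeRing._≈_ (MP F d) g (CommutativeRing.0# (MP F d))
      g≈0 = expand-injective (joint p) (frame p) (dual p) (spanning p) g
        (coef-ext n λ α → trans (stable λ nz →
          ¬¬-minimal degree (λ α → ¬ (coef n (expandAt p g) α ≈ 0#)) (α , nz)
            λ { (β , nz′ , low) → none (β , nz′ , λ γ lt → stable (low γ lt)) }) (sym (coef-0 n α)))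

    double-count : ∀ g → Filtration.V (degreeFiltration F d) D g → All (λ ψ → proj₁ ψ g ≈ 0#) conditions →
      (α : Fin N → Vec ℕ n) → (∀ p → ¬ (coef n (expandAt p g) (α p) ≈ 0#)) →
      (∀ p β → degree β ℕ.< degree (α p) → coef n (expandAt p g) β ≈ 0#) → N ℕ.* suc M ℕ.≤ L ℕ.* D
    double-count g g-degree vanish α nz low = begin
      N ℕ.* suc M
        ≤⟨ sum-≥ N (λ p → dot normal (α p)) (suc M) (λ p →
             Normal.nonzero⇒≤ (suc M) (expandAt p g) (α p)
               (SameFlat.vanishing-transfer p (rep (flat p)) (≡.sym (rep-flat p)) (suc M) g
                 (conditions-suffice g g-degree vanish (flat p))) (nz p)) ⟩
      ℕΣ.sum {N} (λ p → dot normal (α p))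
        -- A line coordinate of a joint is tangential to exactly one of the lines and a flat
        -- coordinate to none, so the normal weight splits as a sum over the lines.
        ≡⟨ ℕΣ.sum-cong-≗ {N} (λ p → ≡.trans (dot-cong (λ i → ≡.sym (tangential-sum p i)) (α p))
             (dot-sum L (λ l → Along.tangential l p) (α p))) ⟩
      ℕΣ.sum {N} (λ p → ℕΣ.sum {L} (λ l → dot (Along.tangential l p) (α p)))
        ≡⟨ ℕΣ.∑-comm {N} {L} (λ p l → dot (Along.tangential l p) (α p)) ⟩
      ℕΣ.sum {L} (λ l → ℕΣ.sum {N} (λ p → dot (Along.tangential l p) (α p)))
        ≤⟨ sum-≤ L _ D (λ l → Along.line-bound l g D g-degree α nz low) ⟩
      L ℕ.* D ∎
      where open ℕ.≤-Reasoning

-- Reduction to a field with stable equality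

module _ {c ℓ} (𝔽 : Field c ℓ) where
  open Field 𝔽 hiding (zero)

  private
    η : ∀ {x y} → x ≈ y → ¬ ¬ (x ≈ y)
    η p k = k p

    η₂ : ∀ {x y u v w z} → (x ≈ y → u ≈ v → w ≈ z) → ¬ ¬ (x ≈ y) → ¬ ¬ (u ≈ v) → ¬ ¬ (w ≈ z)
    η₂ f p q k = p λ x → q λ y → k (f x y)

  -- The conclusion is a decidable inequality, so nothing is lost by coarsening the equality of
  -- the field to its double negation, for which it becomes stable.
  ¬¬-ring : CommutativeRing c ℓ
  ¬¬-ring = record
    { Carrier = Carrier ; _≈_ = λ x y → ¬ ¬ (x ≈ y)
    ; _+_ = _+_ ; _*_ = _*_ ; -_ = λ x → - x ; 0# = 0# ; 1# = 1#
    ; isCommutativeRing = record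
      { isRing = record
        { +-isAbelianGroup = record
          { isGroup = record
            { isMonoid = record
              { isSemigroup = record
                { isMagma = record
                  { isEquivalence = record
                    { refl = η refl ; sym = λ p k → p (k ∘ sym) ; trans = η₂ trans }
                  ; ∙-cong = η₂ +-cong }
                ; assoc = λ x y z → η (+-assoc x y z) }
              ; identity = (λ x → η (+-identityˡ x)) , (λ x → η (+-identityʳ x)) }
            ; inverse = (λ x → η (-‿inverseˡ x)) , (λ x → η (-‿inverseʳ x))
            ; ⁻¹-cong = λ p k → p (k ∘ -‿cong) }
          ; comm = λ x y → η (+-comm x y) }
        ; *-cong = η₂ *-cong
        ; *-assoc = λ x y z → η (*-assoc x y z)
        ; *-identity = (λ x → η (*-identityˡ x)) , (λ x → η (*-identityʳ x))
        ; distrib = (λ x y z → η (distribˡ x y z)) , (λ x y z → η (distribʳ x y z)) }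
      ; *-comm = λ x y → η (*-comm x y) } }

  -- Negated equality is the same for the coarse and the original relation, a triple negation being
  -- a single one; so inverses and 1 ≠ 0 carry over.
  ¬¬-field : StableField c ℓ
  ¬¬-field = record
    { ring₀ = ¬¬-ring
    ; stable = λ p k → p λ q → q k
    ; 1≉0 = λ p → p 1≉0
    ; inverse = λ x x≉0 → let (y , p) = inverse x (λ q → x≉0 (η q)) in y , η p }

-- From lists to an indexed configuration

lookup-AllPairs : ∀ {a r} {A : Set a} {R : A → A → Set r} → (∀ {x y} → R x y → R y x) →
  ∀ {xs} → AllPairs R xs → ∀ i j → i ≢ j → R (List.lookup xs i) (List.lookup xs j)
lookup-AllPairs R-sym (h ∷ hs) zero    zero    i≢j = ⊥-elim (i≢j ≡.refl)
lookup-AllPairs R-sym (h ∷ hs) zero    (suc j) i≢j = All.lookup h (∈-lookup j)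
lookup-AllPairs R-sym (h ∷ hs) (suc i) zero    i≢j = R-sym (All.lookup h (∈-lookup i))
lookup-AllPairs R-sym (h ∷ hs) (suc i) (suc j) i≢j = lookup-AllPairs R-sym hs i j (i≢j ∘ ≡.cong suc)

representative : ∀ {N K} (f : Fin (suc N) → Fin K) →
  Σ (Fin K → Fin (suc N)) λ rep → ∀ p → f (rep (f p)) ≡ f p
representative {N} f = (λ y → choose y (hit? y)) , λ p → correct p (hit? (f p))
  where
  hit? : ∀ y → Dec (∃[ p ] f p ≡ y)
  hit? y = Fin.any? (λ p → f p Fin.≟ y)
  choose : ∀ y → Dec (∃[ p ] f p ≡ y) → Fin (suc N)
  choose y (yes (p , _)) = p
  -- A flat without joints receives an arbitrary one: its extra conditions do no harm, as the count
  -- is by flats in any case.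
  choose y (no _)        = zero
  correct : ∀ p (d : Dec (∃[ q ] f q ≡ f p)) → f (choose (f p) d) ≡ f p
  correct p (yes (q , fq≡fp)) = fq≡fp
  correct p (no none)         = ⊥-elim (none (p , ≡.refl))

module _ {c ℓ} (𝔽 : Field c ℓ) {d m k : ℕ} where
  open Field 𝔽 using (Carrier; _≈_; _+_; _*_; sym; trans; reflexive; commutativeRing; +-cong; *-congʳ; *-congˡ; semiring)
  open LinearAlgebra 𝔽
  open SemiringSum semiring

  lincomb-sum : ∀ r a (w : Fin r → Vect d) j → lincomb r a w j ≡ sum {r} (λ i → a i * w i j)
  lincomb-sum zero    a w j = ≡.refl
  lincomb-sum (suc r) a w j = ≡.cong (a zero * w zero j +_) (lincomb-sum r (a ∘ suc) (w ∘ suc) j)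

  module _ (𝒥 : List (Vect d)) (ℒ : List (Line d)) (ℱ : List (Flat d k))
    (distinct : AllPairs (λ p q → ¬ (p ≈ᵥ q)) 𝒥) (joints : All (IsJoint m ℒ ℱ) 𝒥) where
    private
      point : Fin (length 𝒥) → Vect d
      point = List.lookup 𝒥

      module J (p : Fin (length 𝒥)) where
        isJoint : IsJoint m ℒ ℱ (point p)
        isJoint = All.lookup joints (∈-lookup p)
        lines : Fin m → Line d
        lines = proj₁ isJoint
        flat : Flat d k
        flat = proj₁ (proj₂ isJoint)
        lines∈ : ∀ i → lines i ∈ ℒ
        lines∈ = proj₁ (proj₂ (proj₂ isJoint))
        flat∈ : flat ∈ ℱ
        flat∈ = proj₁ (proj₂ (proj₂ (proj₂ isJoint)))
        onLine : ∀ i → OnLine (point p) (lines i)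
        onLine = proj₁ (proj₂ (proj₂ (proj₂ (proj₂ isJoint))))
        onFlat : OnFlat (point p) flat
        onFlat = proj₁ (proj₂ (proj₂ (proj₂ (proj₂ (proj₂ isJoint)))))
        spans : Spans lines flat
        spans = proj₂ (proj₂ (proj₂ (proj₂ (proj₂ (proj₂ isJoint)))))

      line′ : Fin (length 𝒥) → Fin m → Fin (length ℒ)
      line′ p i = index (J.lines∈ p i)
      flat′ : Fin (length 𝒥) → Fin (length ℱ)
      flat′ p = index (J.flat∈ p)
      line≡ : ∀ p i → J.lines p i ≡ List.lookup ℒ (line′ p i)
      line≡ p i = lookup-index (J.lines∈ p i)
      flat≡ : ∀ p → J.flat p ≡ List.lookup ℱ (flat′ p)
      flat≡ p = lookup-index (J.flat∈ p)

      frame : Fin (length 𝒥) → Fin (m ℕ.+ k) → Vect d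
      frame p = (Line.dir ∘ List.lookup ℒ ∘ line′ p) ++ Flat.dirs (List.lookup ℱ (flat′ p))

      -- Spanning is applied to the standard basis vectors, which is where the one-sided inverse of
      -- the frame comes from.
      dual : Fin (length 𝒥) → Fin d → Fin (m ℕ.+ k) → Carrier
      dual p j = let (a , b , _) = J.spans p (δ commutativeRing j) in a ++ b

      spanning : ∀ p → IsSpanning commutativeRing (frame p) (dual p)
      spanning p j j′ = let (a , b , eq) = J.spans p (δ commutativeRing j) in
        trans (sum-++ commutativeRing m k (λ i → dual p j i * frame p i j′))
          (trans (+-cong
            (trans (sum-cong-≋ {m} λ i → reflexive (≡.cong₂ _*_ (lookup-++ˡ a b i)
                (≡.trans (≡.cong (λ f → f j′) (lookup-++ˡ (Line.dir ∘ List.lookup ℒ ∘ line′ p) (Flat.dirs (List.lookup ℱ (flat′ p))) i))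
                  (≡.cong (λ l → Line.dir l j′) (≡.sym (line≡ p i))))))
              (reflexive (≡.sym (lincomb-sum m a (λ i → Line.dir (J.lines p i)) j′))))
            (trans (sum-cong-≋ {k} λ i → reflexive (≡.cong₂ _*_ (lookup-++ʳ a b i)
                (≡.trans (≡.cong (λ f → f j′) (lookup-++ʳ (Line.dir ∘ List.lookup ℒ ∘ line′ p) (Flat.dirs (List.lookup ℱ (flat′ p))) i))
                  (≡.cong (λ f → Flat.dirs f i j′) (≡.sym (flat≡ p))))))
              (reflexive (≡.sym (lincomb-sum k b (Flat.dirs (J.flat p)) j′)))))
            (sym (eq j′)))

    configuration : Configuration (¬¬-field 𝔽) d m k (length 𝒥) (length ℒ) (length ℱ)
    configuration = record
      { joint = point
      ; lineBase = Line.base ∘ List.lookup ℒ ; lineDir = Line.dir ∘ List.lookup ℒ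
      ; flatBase = Flat.base ∘ List.lookup ℱ ; flatDir = Flat.dirs ∘ List.lookup ℱ
      ; line = line′ ; flat = flat′
      ; time = λ p i → proj₁ (J.onLine p i)
      ; on-line = λ p i j none → none (≡.subst
          (λ l → point p j ≈ Line.base l j + proj₁ (J.onLine p i) * Line.dir l j)
          (line≡ p i) (proj₂ (J.onLine p i) j))
      ; flatCoord = λ p → proj₁ (J.onFlat p)
      ; on-flat = λ p j none → none (≡.subst
          (λ f → point p j ≈ Flat.base f j + sum {k} (λ i → proj₁ (J.onFlat p) i * Flat.dirs f i j))
          (flat≡ p) (trans (proj₂ (J.onFlat p) j)
            (+-cong (reflexive ≡.refl) (reflexive (lincomb-sum k (proj₁ (J.onFlat p)) (Flat.dirs (J.flat p)) j)))))
      ; dual = dual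
      ; spanning = λ p j j′ none → none (≡.subst (sum {m ℕ.+ k} (λ i → dual p j i * frame p i j′) ≈_) (δ-¬¬ j j′) (spanning p j j′))
      -- Coarse equality negates twice in each coordinate; as there are finitely many coordinates,
      -- the double negation moves outside and meets the negated equality of the points.
      ; distinct = λ p q p≢q p≈q → ¬¬-∀Fin d p≈q
          (lookup-AllPairs (λ h p≈q → h (λ i → sym (p≈q i))) distinct p q p≢q) }
      where
      δ-¬¬ : ∀ {d} (i j : Fin d) → δ commutativeRing i j ≡ δ (¬¬-ring 𝔽) i j
      δ-¬¬ zero    zero    = ≡.refl
      δ-¬¬ zero    (suc j) = ≡.refl
      δ-¬¬ (suc i) zero    = ≡.refl
      δ-¬¬ (suc i) (suc j) = δ-¬¬ i j

open import Data.Nat using (_≤_; _<_; _∸_; _*_; _^_)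

-- The m-th power of the bound, which avoids roots. If it fails, `parameters` with X = K C(d,m)
-- yields a multiplicity and a degree that contradict `multiplicity-bound`. The case of no joints is
-- separate since representatives of flats are joints.
configuration-bound : ∀ {c ℓ} (𝔽 : StableField c ℓ) {d m N L K} → 1 ≤ m → m ≤ d →
  Configuration 𝔽 d m (d ∸ m) N L K → N ^ m ≤ (d C m) * (L ^ m * K)
configuration-bound 𝔽 {m = suc m} {N = zero}  1≤m m≤d config = ℕ.z≤n
configuration-bound 𝔽 {d} {m} {N@(suc _)} {L} {K} 1≤m m≤d config = ℕ.≮⇒≥ λ large →
  contradict (Counting.parameters N L (K * (d C m)) m 1≤m (ℕ.s≤s ℕ.z≤n)
    (≡.subst (_< N ^ m) (rearrange (d C m) (L ^ m) K) large))
  where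
  rearrange : ∀ a b c → a * (b * c) ≡ b * (c * a)
  rearrange a b c = ≡.trans (ℕ.*-comm a (b * c)) (ℕ.*-assoc b c a)
  contradict : ¬ (∃[ M ] ∃[ D ] (L * D < N * suc M × K * (d C m) * (M ℕ.+ m) ^ m < suc D ^ m))
  contradict (M , D , LD<NM , gap) = ℕ.<⇒≱ LD<NM
    (JointsBound.multiplicity-bound 𝔽 config M D (proj₁ rep) (proj₂ rep)
      (Counting.dimension-gap d m D M K m≤d gap))
    where rep = representative (Configuration.flat config)

theorem4p2 : ∀ {c ℓ} (𝔽 : Field c ℓ) (d m : ℕ) → 1 ≤ m → m < d →
    let open LinearAlgebra 𝔽 in
    (𝒥 : List (Vect d)) (ℒ : List (Line d)) (ℱ : List (Flat d (d ∸ m))) →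
    AllPairs (λ p q → ¬ (p ≈ᵥ q)) 𝒥 →
    All (IsJoint m ℒ ℱ) 𝒥 →
    length 𝒥 ^ m ≤ (d C m) * (length ℒ ^ m * length ℱ)
theorem4p2 𝔽 d m 1≤m m<d 𝒥 ℒ ℱ distinct joints =
  configuration-bound (¬¬-field 𝔽) 1≤m (ℕ.<⇒≤ m<d) (configuration 𝔽 𝒥 ℒ ℱ distinct joints)
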